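{- There is a polynomial-space algorithm that, given a graph of order $n$ without isolated vertices, enumerates all unique response Roman dominating functions of this graph with polynomial delay and in total time $\mathcal{O}^*(\sqrt{3}^{\,n})$.
   Context: Graphs are finite, simple and undirected; the order is the number of vertices. A function $f:V\to\{0,1,2\}$ is a unique response Roman dominating function on $G=(V,E)$ if (i) every vertex $v$ with $f(v)=0$ has exactly one neighbor $u$ with $f(u)=2$, and (ii) every vertex $v$ with $f(v)\ge 1$ has no neighbor $u$ with $f(u)=2$. (All such functions are enumerated, each exactly once, not only minimal ones.) An enumeration algorithm has polynomial delay if the time between two subsequent outputs, the time from the start to the first output, and the time from the last output to termination are all bounded by a polynomial in the input size. $\mathcal{O}^*$ suppresses factors polynomial in the input size. -}

module Defs where

open import Data.Bool using (Bool; true; false; if_then_else_)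
open import Data.Fin using (Fin; toℕ)
open import Data.List using (List; []; _∷_; _++_; map; concatMap; tabulate; allFin)
open import Data.List.Membership.Propositional using (_∈_)
open import Data.List.Relation.Unary.Linked using (Linked)
open import Data.List.Relation.Unary.Unique.Propositional using (Unique)
open import Data.Nat using (ℕ; zero; suc; _+_; _*_; _∸_; _≤_)
open import Data.Nat.GeneralisedArithmetic using (fold)
open import Data.Nat.ListAction using (sum)
open import Data.Nat.Logarithm using (⌊log₂_⌋)
open import Data.Product using (Σ-syntax; ∃; ∃!; _×_; proj₁; proj₂; _,_)
open import Function using (_∘_; _⇔_)
open import Relation.Binary.PropositionalEquality using (_≡_)
open import Relation.Nullary using (¬_)

record Graph (n : ℕ) : Set where
  field
    adj    : Fin n → Fin n → Bool
    sym    : ∀ u v → adj u v ≡ adj v u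
    irrefl : ∀ v → adj v v ≡ false

  _~_ : Fin n → Fin n → Set
  u ~ v = adj u v ≡ true

NoIsolatedVertices : ∀ {n} → Graph n → Set
NoIsolatedVertices G = ∀ v → ∃ λ u → v ~ u
  where open Graph G

record IsURRDF {n} (G : Graph n) (f : Fin n → Fin 3) : Set where
  open Graph G
  field
    unique-response : ∀ v → toℕ (f v) ≡ 0 → ∃! _≡_ (λ u → v ~ u × toℕ (f u) ≡ 2)
    no-response     : ∀ v → 1 ≤ toℕ (f v) → ¬ (∃ λ u → v ~ u × toℕ (f u) ≡ 2)

-- Random access machines with structured control flow, a read-only
-- random-access input and a write-only output.  Registers hold natural
-- numbers.  M[a] is the content of register a, I[a] the a-th input cell.
data Command : Set where
  const        : (x k : ℕ) → Command    -- M[x] := k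
  add sub      : (x y z : ℕ) → Command  -- M[x] := M[y] + M[z],  M[y] ∸ M[z]
  load         : (x y : ℕ) → Command    -- M[x] := M[M[y]]
  store        : (x y : ℕ) → Command    -- M[M[x]] := M[y]
  input        : (x y : ℕ) → Command    -- M[x] := I[M[y]]
  write        : (x : ℕ) → Command      -- append M[x] to the current output word
  emit         : Command                -- output the current word, start a new one
  ifNonzero    : (x : ℕ) (c d : List Command) → Command
  whileNonzero : (x : ℕ) (c : List Command) → Command

Program : Set
Program = List Command

-- Cells beyond the end of the list contain 0.
Memory : Set
Memory = List ℕ

_[_] : Memory → ℕ → ℕ
[]      [ _     ] = 0
(v ∷ m) [ zero  ] = v
(v ∷ m) [ suc a ] = m [ a ]

_[_]≔_ : Memory → ℕ → ℕ → Memory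
[]      [ zero  ]≔ v = v ∷ []
[]      [ suc a ]≔ v = 0 ∷ ([] [ a ]≔ v)
(_ ∷ m) [ zero  ]≔ v = v ∷ m
(w ∷ m) [ suc a ]≔ v = w ∷ (m [ a ]≔ v)

-- The number of bits occupied by a memory: each cell up to the highest
-- one ever written to counts with the length of its binary representation.
bits : Memory → ℕ
bits = sum ∘ map (λ v → suc ⌊log₂ v ⌋)

Word : Set
Word = List ℕ

record Config : Set where
  constructor config
  field
    code   : Program             -- what remains to be executed
    memory : Memory
    word   : Word                -- the output word under construction
    log    : List (ℕ × Word)     -- all outputs so far, oldest first, with their times
    clock  : ℕ                   -- the number of steps executed so far

open Config public

ifZero_then_else_ : ∀ {A : Set} → ℕ → A → A → A
ifZero zero  then a else b = a
ifZero suc _ then a else b = b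

-- The remaining code always is a concatenation of boundedly many pieces of
-- the program text, so it plays the role of a program counter and is not
-- charged as memory.
--
-- Unit-cost time is adequate in combination with a polynomial bound on
-- `bits`: the operands then have polynomially many bits, so charging
-- each step by the lengths of its operands costs a polynomial factor only.
step : Memory → Config → Config
step I (config []                      m w l t) = config [] m w l t
step I (config (const x k ∷ p)         m w l t) = config p (m [ x ]≔ k) w l (suc t)
step I (config (add x y z ∷ p)         m w l t) = config p (m [ x ]≔ (m [ y ] + m [ z ])) w l (suc t)
step I (config (sub x y z ∷ p)         m w l t) = config p (m [ x ]≔ (m [ y ] ∸ m [ z ])) w l (suc t)
step I (config (load x y ∷ p)          m w l t) = config p (m [ x ]≔ (m [ m [ y ] ])) w l (suc t)
step I (config (store x y ∷ p)         m w l t) = config p (m [ m [ x ] ]≔ (m [ y ])) w l (suc t)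
step I (config (input x y ∷ p)         m w l t) = config p (m [ x ]≔ (I [ m [ y ] ])) w l (suc t)
step I (config (write x ∷ p)           m w l t) = config p m (w ++ m [ x ] ∷ []) l (suc t)
step I (config (emit ∷ p)              m w l t) = config p m [] (l ++ (suc t , w) ∷ []) (suc t)
step I (config (ifNonzero x c d ∷ p)   m w l t) =
  config (ifZero m [ x ] then d ++ p else (c ++ p)) m w l (suc t)
step I (config (whileNonzero x c ∷ p)  m w l t) =
  config (ifZero m [ x ] then p else (c ++ whileNonzero x c ∷ p)) m w l (suc t)

run : Program → Memory → ℕ → Config
run p I = fold (config p [] [] [] 0) (step I)

Halted : Config → Set
Halted c = code c ≡ []

outputTimes : Config → List ℕ
outputTimes = map proj₁ ∘ log

outputs : Config → List Word
outputs = map proj₂ ∘ log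

Enumerates : List Word → (Word → Set) → Set
Enumerates ws P = Unique ws × (∀ w → w ∈ ws ⇔ P w)

-- Meant for halted configurations, whose clock shows the total running time.
DelayAtMost : ℕ → Config → Set
DelayAtMost d c = Linked (λ s t → t ≤ s + d) (0 ∷ outputTimes c ++ clock c ∷ [])

data Polynomial : Set where
  con       : ℕ → Polynomial
  var       : Polynomial
  _⊕_ _⊗_   : Polynomial → Polynomial → Polynomial

⟦_⟧ : Polynomial → ℕ → ℕ
⟦ con k ⟧ s = k
⟦ var   ⟧ s = s
⟦ p ⊕ q ⟧ s = ⟦ p ⟧ s + ⟦ q ⟧ s
⟦ p ⊗ q ⟧ s = ⟦ p ⟧ s * ⟦ q ⟧ s

-- The order, followed by the adjacency matrix row by row.
encode : ∀ {n} → Graph n → Memory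
encode {n} G = n ∷ concatMap (λ u → map (λ v → if adj u v then 1 else 0) (allFin n)) (allFin n)
  where open Graph G

inputSize : ∀ {n} → Graph n → ℕ
inputSize G = bits (encode G)

values : ∀ {n} → (Fin n → Fin 3) → Word
values f = tabulate (toℕ ∘ f)

EncodesURRDF : ∀ {n} → Graph n → Word → Set
EncodesURRDF {n} G w = Σ[ f ∈ (Fin n → Fin 3) ] IsURRDF G f × w ≡ values f

module Submission where

-- The set of vertices of value 2 of a unique response Roman dominating
-- function meets every closed neighbourhood in at most one vertex, and it
-- determines the function; conversely every such packing A arises, and the
-- value at v is 1 + 2 A(v) minus the number of elements of A in N[v].
--
-- Subsets of packings are packings, so the packings, read as binary numbers,
-- can be run through in increasing order by a counter: at position i, a 1 is
-- cleared, and a 0 is turned into a 1 if this yields a packing (all lower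
-- positions being 0), in which case the result is output and the counter
-- returns to position 0.  The counter halts when it runs past the last
-- position, hence between two outputs there are at most n + 1 tests.
--
-- A graph without isolated vertices has a spanning forest of stars with at
-- least two vertices each.  A packing contains at most one vertex of a star,
-- and (k + 1)² ≤ 3ᵏ for k ≥ 2, so the number of packings squared is at most 3ⁿ.

open import Defs
open import Data.Bool using (Bool; true; false; if_then_else_; T; _∧_)
open import Data.Bool.Properties using (T-∧)
open import Data.Empty using (⊥; ⊥-elim)
open import Data.Fin using (Fin; zero; suc; toℕ; fromℕ<)
import Data.Fin.Properties as Fin
open import Data.List
  using (List; []; _∷_; _++_; _ʳ++_; map; length; foldl; reverse; concatMap; tabulate; allFin; cartesianProductWith)
open import Data.List.Membership.Propositional using (_∈_)
import Data.List.Membership.DecPropositional as DecMembership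
open import Data.List.Membership.Propositional.Properties
  using (∈-++⁻; ∈-++⁺ˡ; ∈-++⁺ʳ; ∈-∃++; ∈-map⁺; ∈-map⁻; ∈-cartesianProductWith⁺; ∈-allFin)
open import Data.List.Properties
  using (length-map; length-++; length-reverse; length-tabulate; map-++; map-tabulate; tabulate-cong;
         ++-assoc; ++-identityʳ; reverse-involutive; ∷-injective)
open import Data.List.Relation.Binary.Permutation.Propositional using (_↭_; ↭-sym; ↭-trans; ↭⇒↭ₛ)
import Data.List.Relation.Binary.Permutation.Propositional as Perm
open import Data.List.Relation.Binary.Permutation.Propositional.Properties using (∈-resp-↭; shift)
import Data.List.Relation.Binary.Permutation.Propositional.Properties as Perm
import Data.List.Relation.Binary.Permutation.Setoid.Properties as SetoidPerm
open import Data.List.Relation.Unary.All as All using (All; []; _∷_)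
import Data.List.Relation.Unary.All.Properties as All
open import Data.List.Relation.Unary.AllPairs using ([]; _∷_)
open import Data.List.Relation.Unary.Any using (here; there)
open import Data.List.Relation.Unary.Linked using (Linked; [-]; _∷_)
open import Data.List.Relation.Unary.Unique.Propositional using (Unique)
import Data.List.Relation.Unary.Unique.Propositional.Properties as Unique
open import Data.Maybe using (Maybe; just; nothing)
open import Data.Nat
open import Data.Nat.GeneralisedArithmetic using (fold)
open import Data.Nat.ListAction using (sum)
open import Data.Nat.Logarithm using (⌊log₂_⌋; ⌊log₂⌋-mono-≤; ⌊log₂[2^n]⌋≡n)
open import Data.Nat.Properties
open import Data.Nat.Tactic.RingSolver using (solve-∀)
open import Data.Product using (Σ-syntax; ∃; ∃!; _×_; _,_; proj₁; proj₂)
open import Data.Sum using (_⊎_; inj₁; inj₂)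
open import Data.Unit using (⊤; tt)
open import Function using (_∘_; mk⇔; Equivalence)
open import Relation.Nullary using (yes; no; contradiction)
open import Relation.Binary.PropositionalEquality hiding ([_])

-- The machine

set-length : ∀ m {x v k} → x < k → length m ≤ k → length (m [ x ]≔ v) ≤ k
set-length []      {zero}  (s≤s _) _         = s≤s z≤n
set-length []      {suc x} (s≤s p) _         = s≤s (set-length [] p z≤n)
set-length (_ ∷ m) {zero}  _       q         = q
set-length (_ ∷ m) {suc x} (s≤s p) (s≤s q)   = s≤s (set-length m p q)

set-≤ : ∀ m {x v b} → v ≤ b → (∀ a → m [ a ] ≤ b) → ∀ a → (m [ x ]≔ v) [ a ] ≤ b
set-≤ []      {zero}  p q zero    = p
set-≤ []      {zero}  p q (suc a) = z≤n
set-≤ []      {suc x} p q zero    = z≤n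
set-≤ []      {suc x} p q (suc a) = set-≤ [] {x} p (λ _ → z≤n) a
set-≤ (_ ∷ m) {zero}  p q zero    = p
set-≤ (_ ∷ m) {zero}  p q (suc a) = q (suc a)
set-≤ (_ ∷ m) {suc x} p q zero    = q zero
set-≤ (_ ∷ m) {suc x} p q (suc a) = set-≤ m {x} p (q ∘ suc) a

-- Length and cell size together bound `bits`, so polynomial space follows once both bounds survive
-- every step of the run.
record Safe (L B : ℕ) (m : Memory) : Set where
  constructor safe
  field
    length-≤ : length m ≤ L
    cell-≤   : ∀ a → m [ a ] ≤ B

-- R is the number of registers with fixed addresses; L and B bound the length
-- of the memory and the contents of its cells.
module Execution (R L B : ℕ) (I : Memory) where

  -- Only additions create new large values, and only stores can leave the
  -- fixed registers, so nothing else has to be bounded along an execution.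
  Fits : Config → Set
  Fits (config (const x k ∷ _) m _ _ _) = T ((x <ᵇ R) ∧ (k ≤ᵇ R))
  Fits (config (add x y z ∷ _) m _ _ _) = T (x <ᵇ R) × m [ y ] + m [ z ] ≤ B
  Fits (config (sub x _ _ ∷ _) m _ _ _) = T (x <ᵇ R)
  Fits (config (load x _ ∷ _)  m _ _ _) = T (x <ᵇ R)
  Fits (config (input x _ ∷ _) m _ _ _) = T (x <ᵇ R)
  Fits (config (store x _ ∷ _) m _ _ _) = m [ x ] < L
  Fits _                                = ⊤

  infixr 5 _▸_
  infix 4 _⇝_

  -- Each intermediate configuration is computed by `step`, so the trace of straight-line code is
  -- just the chain of its side conditions, most of them `tt`.
  data _⇝_ : Config → Config → Set where
    stop : ∀ {c} → c ⇝ c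
    _▸_  : ∀ {c c′} → Fits c → step I c ⇝ c′ → c ⇝ c′

  infixr 4 _⨾_
  _⨾_ : ∀ {c c′ c″} → c ⇝ c′ → c′ ⇝ c″ → c ⇝ c″
  stop    ⨾ s = s
  (f ▸ r) ⨾ s = f ▸ (r ⨾ s)

  -- `fold` puts the last step outermost, whereas a trace exposes the first one.
  fold-step : ∀ c k → fold (step I c) (step I) k ≡ fold c (step I) (suc k)
  fold-step c zero    = refl
  fold-step c (suc k) = cong (step I) (fold-step c k)

  steps : ∀ {c c′} → c ⇝ c′ → Σ[ k ∈ ℕ ] fold c (step I) k ≡ c′
  steps stop = 0 , refl
  steps (_ ▸ r) with k , eq ← steps r = suc k , trans (sym (fold-step _ k)) eq

  module _ (R≤L : R ≤ L) (R≤B : R ≤ B) (I≤B : ∀ a → I [ a ] ≤ B) where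

    private
      ok : ∀ m x v → T (x <ᵇ R) → v ≤ B → Safe L B m → Safe L B (m [ x ]≔ v)
      ok m x v p q (safe l c) =
        safe (set-length m (≤-trans (<ᵇ⇒< x R p) R≤L) l) (set-≤ m {x} q c)

    safe-step : ∀ c → Fits c → Safe L B (memory c) → Safe L B (memory (step I c))
    safe-step (config [] m w l t) f s = s
    safe-step (config (const x k ∷ p) m w l t) f s with p₁ , p₂ ← Equivalence.to (T-∧ {x <ᵇ R}) f =
      ok m x _ p₁ (≤-trans (≤ᵇ⇒≤ k R p₂) R≤B) s
    safe-step (config (add x y z ∷ p) m w l t) (f , b) s = ok m x _ f b s
    safe-step (config (sub x y z ∷ p) m w l t) f s =
      ok m x _ f (≤-trans (m∸n≤m (m [ y ]) (m [ z ])) (Safe.cell-≤ s y)) s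
    safe-step (config (load x y ∷ p) m w l t) f s = ok m x _ f (Safe.cell-≤ s (m [ y ])) s
    safe-step (config (store x y ∷ p) m w l t) f (safe l′ c) =
      safe (set-length m f l′) (set-≤ m {m [ x ]} (c y) c)
    safe-step (config (input x y ∷ p) m w l t) f s = ok m x _ f (I≤B (m [ y ])) s
    safe-step (config (write x ∷ p) m w l t) f s = s
    safe-step (config (emit ∷ p) m w l t) f s = s
    safe-step (config (ifNonzero x c d ∷ p) m w l t) f s = s
    safe-step (config (whileNonzero x c ∷ p) m w l t) f s = s

    halted-safe : ∀ c → Halted c → Safe L B (memory c) → ∀ t → Safe L B (memory (fold c (step I) t))
    halted-safe (config [] m w l t) refl s zero    = s
    halted-safe (config [] m w l t) refl s (suc k) =
      subst (Safe L B ∘ memory) (fold-step _ k) (halted-safe _ refl s k)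

    -- A time `t` lies either inside the trace or beyond its halted end, where the configuration no
    -- longer changes.
    always-safe : ∀ {c c′} → c ⇝ c′ → Halted c′ → Safe L B (memory c) →
                  ∀ t → Safe L B (memory (fold c (step I) t))
    always-safe stop          h s t       = halted-safe _ h s t
    always-safe (f ▸ r)       h s zero    = s
    always-safe {c} (f ▸ r)   h s (suc t) =
      subst (Safe L B ∘ memory) (fold-step c t) (always-safe r h (safe-step c f s) t)

-- The program

-- Register 0 holds the order, 1 and 13 the constants one and zero.  The bits of
-- the candidate set occupy the cells from 14 on.  Register 2 is the address of
-- the current position of the counter, 3 the number of positions from there on,
-- and 4 the outcome of the last check.  A scan runs with the input address 5
-- through the rows of the adjacency matrix; 6 and 7 are the address of the bit
-- of the row's vertex and the number of rows left, 9 and 10 the same for the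
-- columns, and 8 is the number of elements in the vertex's closed neighbourhood.
row : Program
row = input 11 5 ∷ load 12 9 ∷ sub 11 1 11 ∷ sub 12 12 11 ∷ add 8 12 8
    ∷ add 5 1 5 ∷ add 9 1 9 ∷ sub 10 10 1 ∷ []

line : Program → Program
line act = load 8 6 ∷ const 9 14 ∷ add 10 13 0 ∷ whileNonzero 10 row ∷ act

scan : Program → Program
scan act = const 5 1 ∷ const 6 14 ∷ add 7 13 0 ∷ whileNonzero 7 (line act) ∷ []

-- `check` adds the truncated difference s ∸ 1 to the outcome, which therefore receives a positive
-- contribution exactly from the closed neighbourhoods met more than once.
next check print : Program
next  = add 6 1 6 ∷ sub 7 7 1 ∷ []
check = sub 8 8 1 ∷ add 4 8 4 ∷ next
print = load 12 6 ∷ add 12 12 12 ∷ add 12 1 12 ∷ sub 12 12 8 ∷ write 12 ∷ next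

announce : Program
announce = scan print ++ emit ∷ const 2 14 ∷ add 3 13 0 ∷ []

advance : Program
advance = store 2 13 ∷ add 2 1 2 ∷ sub 3 3 1 ∷ []

-- A bit that already is 1 is counted into the outcome, as if the check had failed.
attempt : Program
attempt = load 4 2 ∷ store 2 1 ∷ scan check ++ ifNonzero 4 advance announce ∷ []

-- The zero stored at address 13 + n allocates all n bits at once and gives the memory its final
-- length; for n = 0 the store only hits register 13 again.
initialise : Program
initialise = input 0 0 ∷ const 1 1 ∷ const 2 13 ∷ add 2 2 0 ∷ const 13 0 ∷ store 2 13 ∷ []

program : Program
program = initialise ++ announce ++ whileNonzero 3 attempt ∷ []

-- Registers 5 to 12 carry no information from one scan to the next, so the traces of whole scans
-- quantify over them existentially.
record Scratch : Set where
  constructor scratch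
  field
    p r c s j k e a : ℕ

bit : Bool → ℕ
bit b = if b then 1 else 0

cells : List Bool → Memory
cells = map bit

bit-≤1 : ∀ b → bit b ≤ 1
bit-≤1 false = z≤n
bit-≤1 true  = ≤-refl

cells-≤1 : ∀ A i → cells A [ i ] ≤ 1
cells-≤1 []      i       = z≤n
cells-≤1 (b ∷ A) zero    = bit-≤1 b
cells-≤1 (b ∷ A) (suc i) = cells-≤1 A i

-- The same scan serves for checking and for printing. An effect describes how the row of a vertex
-- with closed sum s and bit a changes the pair of outcome and output word.
Effect : Set
Effect = ℕ × Word → ℕ × ℕ → ℕ × Word

checking printing : Effect
checking (bad , w) (s , _) = (s ∸ 1) + bad , w
printing (bad , w) (s , a) = bad , w ++ (1 + (a + a) ∸ s) ∷ []

excessOf : List (ℕ × ℕ) → ℕ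
excessOf = sum ∘ map (λ (s , _) → s ∸ 1)

labelsOf : List (ℕ × ℕ) → Word
labelsOf = map (λ (s , a) → 1 + (a + a) ∸ s)

foldl-checking : ∀ ls bad w → foldl checking (bad , w) ls ≡ (excessOf ls + bad , w)
foldl-checking []             bad w = refl
foldl-checking ((s , a) ∷ ls) bad w = trans (foldl-checking ls _ w)
  (cong (_, w) (trans (sym (+-assoc (excessOf ls) (s ∸ 1) bad)) (cong (_+ bad) (+-comm (excessOf ls) (s ∸ 1)))))

foldl-printing : ∀ ls bad w → foldl printing (bad , w) ls ≡ (bad , w ++ labelsOf ls)
foldl-printing []       bad w = cong (bad ,_) (sym (++-identityʳ w))
foldl-printing (_ ∷ ls) bad w = trans (foldl-printing ls bad _) (cong (bad ,_) (++-assoc w _ _))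

-- Accumulating makes fill (suc i) V and fill i (false ∷ V) equal by definition,
-- so that no state has to be transported when the counter moves on.
fill : ℕ → List Bool → List Bool
fill zero    V = V
fill (suc i) V = fill i (false ∷ V)

fill-lookup : ∀ i V k → cells (fill i V) [ i + k ] ≡ cells V [ k ]
fill-lookup zero    V k = refl
fill-lookup (suc i) V k = trans (cong (cells (fill i (false ∷ V)) [_]) (sym (+-suc i k)))
  (fill-lookup i (false ∷ V) (suc k))

fill-update : ∀ i V k v V′ → cells V [ k ]≔ v ≡ cells V′ → cells (fill i V) [ i + k ]≔ v ≡ cells (fill i V′)
fill-update zero    V k v V′ eq = eq
fill-update (suc i) V k v V′ eq = trans (cong (cells (fill i (false ∷ V)) [_]≔ v) (sym (+-suc i k)))
  (fill-update i (false ∷ V) (suc k) v (false ∷ V′) (cong (0 ∷_) eq))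

-- The log grows at its end, so delays are tracked from the right, indexed by the time of the latest
-- output (0 if there is none).
data Paced (d : ℕ) : List ℕ → ℕ → Set where
  start  : Paced d [] 0
  output : ∀ {ts s t} → Paced d ts s → t ≤ s + d → Paced d (ts ++ t ∷ []) t

-- Execution traces: scans, attempts and sweeps of the counter

module Program-correctness (n : ℕ) (I : Memory) where

  mem : ℕ → ℕ → ℕ → Scratch → Memory → Memory
  mem pos rem bad (scratch p r c s j k e a) xs =
    n ∷ 1 ∷ pos ∷ rem ∷ bad ∷ p ∷ r ∷ c ∷ s ∷ j ∷ k ∷ e ∷ a ∷ 0 ∷ xs

  -- The largest values that occur are bit addresses, at most 14 + n, and input addresses and
  -- outcomes, at most 1 + n * n.
  L B : ℕ
  L = 14 + n
  B = 14 + (n + n * n)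

  open Execution 14 L B I

  -- For bits x and b, x ∸ (1 ∸ b) is their product; this replaces the multiplication of a
  -- membership bit by an adjacency bit.
  gather : Memory → ℕ → ℕ → ℕ → ℕ → ℕ
  gather xs zero    p u s = s
  gather xs (suc m) p u s = gather xs m (suc p) (suc u) ((xs [ u ] ∸ (1 ∸ I [ p ])) + s)

  lines : Memory → ℕ → ℕ → ℕ → List (ℕ × ℕ)
  lines xs zero    p v = []
  lines xs (suc m) p v = (gather xs n p 0 (xs [ v ]) , xs [ v ]) ∷ lines xs m (n + p) (suc v)

  module _ (xs : Memory) (xs≤1 : ∀ a → xs [ a ] ≤ 1) where

    private
      term≤1 : ∀ u p → xs [ u ] ∸ (1 ∸ I [ p ]) ≤ 1
      term≤1 u p = ≤-trans (m∸n≤m _ (1 ∸ I [ p ])) (xs≤1 u)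

    gather-≤ : ∀ m p u s → gather xs m p u s ≤ m + s
    gather-≤ zero    p u s = ≤-refl
    gather-≤ (suc m) p u s = ≤-trans (gather-≤ m (suc p) (suc u) _)
      (≤-trans (+-monoʳ-≤ m (+-monoˡ-≤ s (term≤1 u p))) (≤-reflexive (+-suc m s)))

    private
      n≤B : ∀ {k} → k ≤ 1 + n → k ≤ B
      n≤B q = ≤-trans q (≤-trans (s≤s (m≤m+n n (n * n))) (m≤n+m _ 13))

    run-cell : ∀ {m pos rem bad p r c s u e a w l t Q} → p ≤ n * n → s ≤ n → u < n →
      config (whileNonzero 10 row ∷ Q) (mem pos rem bad (scratch p r c s (14 + u) (suc m) e a) xs) w l t ⇝
      config (whileNonzero 10 row ∷ Q)
        (mem pos rem bad (scratch (suc p) r c ((xs [ u ] ∸ (1 ∸ I [ p ])) + s) (15 + u) m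
                                  (1 ∸ I [ p ]) (xs [ u ] ∸ (1 ∸ I [ p ]))) xs) w l (9 + t)
    run-cell {p = p} {s = s} {u} bp bs bu =
      tt ▸ tt ▸ tt ▸ tt ▸ tt ▸ (tt , n≤B (+-mono-≤ (term≤1 u p) bs)) ▸ (tt , pB) ▸ (tt , uB) ▸ tt ▸ stop
      where
      pB : suc p ≤ B
      pB = ≤-trans (s≤s (≤-trans bp (m≤n+m (n * n) n))) (m≤n+m _ 13)
      uB : 1 + (14 + u) ≤ B
      uB = ≤-trans (+-monoʳ-≤ 14 bu) (+-monoʳ-≤ 14 (m≤m+n n (n * n)))

    run-row : ∀ m {pos rem bad p r c s u e a w l t Q} →
      m + p ≤ 1 + n * n → m + s ≤ 1 + n → m + u ≤ n →
      Σ[ p′ ∈ ℕ ] Σ[ j′ ∈ ℕ ] Σ[ e′ ∈ ℕ ] Σ[ a′ ∈ ℕ ] Σ[ t′ ∈ ℕ ] p′ ≡ m + p × t′ ≡ 1 + m * 9 + t ×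
      config (whileNonzero 10 row ∷ Q) (mem pos rem bad (scratch p r c s (14 + u) m e a) xs) w l t ⇝
      config Q (mem pos rem bad (scratch p′ r c (gather xs m p u s) j′ 0 e′ a′) xs) w l t′
    run-row zero bp bs bu = _ , _ , _ , _ , _ , refl , refl , tt ▸ stop
    run-row (suc m) {p = p} {s = s} {u} {t = t} bp bs bu
      with p′ , j′ , e′ , a′ , t′ , eqp , eqt , ρ ←
           run-row m {p = suc p} {s = (xs [ u ] ∸ (1 ∸ I [ p ])) + s} {u = suc u} {t = 9 + t}
             (≤-trans (≤-reflexive (+-suc m p)) bp)
             (≤-trans (+-monoʳ-≤ m (+-monoˡ-≤ s (term≤1 u p))) (≤-trans (≤-reflexive (+-suc m s)) bs))
             (≤-trans (≤-reflexive (+-suc m u)) bu)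
      = p′ , j′ , e′ , a′ , t′ , trans eqp (+-suc m p) , trans eqt (lem m t) ,
        (run-cell (≤-pred (≤-trans (s≤s (m≤n+m p m)) bp)) (≤-pred (≤-trans (s≤s (m≤n+m s m)) bs))
                  (≤-trans (s≤s (m≤n+m u m)) bu) ⨾ ρ)
      where
      lem : ∀ m t → 1 + m * 9 + (9 + t) ≡ 1 + (9 + m * 9) + t
      lem m t = cong suc (trans (sym (+-assoc (m * 9) 9 t)) (cong (_+ t) (+-comm (m * 9) 9)))

    -- The outcome starts with the old bit, at most 1, and each row adds at most n; the invariant 1
    -- + v * n keeps register 4 below `B`. The 7 is the length of `print`, the longer of the two
    -- actions.
    Performs : Program → Effect → Set
    Performs act eff = ∀ {pos rem bad p v m s j k e a w l t Q} →
      s ≤ 1 + n → v < n → bad ≤ 1 + v * n →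
      let (bad′ , w′) = eff (bad , w) (s , xs [ v ]) in
      Σ[ s′ ∈ ℕ ] Σ[ a′ ∈ ℕ ] Σ[ t′ ∈ ℕ ] t′ ≤ 7 + t × bad′ ≤ 1 + suc v * n ×
      config (act ++ Q) (mem pos rem bad (scratch p (14 + v) (suc m) s j k e a) xs) w l t ⇝
      config Q (mem pos rem bad′ (scratch p (15 + v) m s′ j k e a′) xs) w′ l t′

    private
      rowB : ∀ {v} → v < n → 15 + v ≤ B
      rowB v<n = ≤-trans (+-monoʳ-≤ 14 v<n) (+-monoʳ-≤ 14 (m≤m+n n (n * n)))

    check-performs : Performs check checking
    check-performs {bad = bad} {v = v} {s = s} s≤ v<n bad≤ =
      _ , _ , _ , +-monoˡ-≤ _ 4≤7 , bad′≤ , tt ▸ (tt , badB) ▸ (tt , rowB v<n) ▸ tt ▸ stop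
      where
      4≤7 : 4 ≤ 7
      4≤7 = m≤m+n 4 3
      bad′≤ : (s ∸ 1) + bad ≤ 1 + suc v * n
      bad′≤ = ≤-trans (+-mono-≤ (∸-monoˡ-≤ 1 s≤) bad≤) (≤-reflexive (+-suc n (v * n)))
      badB : (s ∸ 1) + bad ≤ B
      badB = ≤-trans bad′≤ (≤-trans (s≤s (≤-trans (*-monoˡ-≤ n v<n) (m≤n+m (n * n) n))) (m≤n+m _ 13))

    print-performs : Performs print printing
    print-performs {v = v} s≤ v<n bad≤ =
      _ , _ , _ , ≤-refl , ≤-trans bad≤ (s≤s (m≤n+m (v * n) n)) ,
      tt ▸ (tt , ≤-trans 2a≤2 (m≤m+n 2 _)) ▸ (tt , ≤-trans (s≤s 2a≤2) (m≤m+n 3 _)) ▸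
      tt ▸ tt ▸ (tt , rowB v<n) ▸ tt ▸ stop
      where
      2a≤2 : xs [ v ] + xs [ v ] ≤ 2
      2a≤2 = +-mono-≤ (xs≤1 v) (xs≤1 v)

    private
      m+v≡n⇒v<n : ∀ m {v} → suc m + v ≡ n → v < n
      m+v≡n⇒v<n m {v} eq = subst (v <_) eq (s≤s (m≤n+m v m))

      rowStart≤ : ∀ {p} v → p ≡ 1 + v * n → v < n → n + p ≤ 1 + n * n
      rowStart≤ v refl v<n = ≤-trans (≤-reflexive (+-suc n (v * n))) (s≤s (*-monoˡ-≤ n v<n))

      cellStart≤ : ∀ v → n + xs [ v ] ≤ 1 + n
      cellStart≤ v = ≤-trans (+-monoʳ-≤ n (xs≤1 v)) (≤-reflexive (+-comm n 1))

      -- A row costs one loop test, three set-up instructions, 1 + n * 9 steps of the inner loop and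
      -- at most 7 for the action, in total 12 + n * 9.
      lineTime : ∀ m t t₁ t₂ t₃ → t₁ ≡ 1 + n * 9 + (4 + t) → t₂ ≤ 7 + t₁ → t₃ ≤ 1 + m * (12 + n * 9) + t₂ →
        t₃ ≤ 1 + suc m * (12 + n * 9) + t
      lineTime m t t₁ t₂ t₃ eqt₁ t₂≤ t₃≤ = begin
        t₃                                                 ≤⟨ t₃≤ ⟩
        1 + m * (12 + n * 9) + t₂                          ≤⟨ +-monoʳ-≤ (1 + m * (12 + n * 9)) t₂≤ ⟩
        1 + m * (12 + n * 9) + (7 + t₁)                    ≡⟨ cong (λ x → 1 + m * (12 + n * 9) + (7 + x)) eqt₁ ⟩
        1 + m * (12 + n * 9) + (7 + (1 + n * 9 + (4 + t))) ≡⟨ rearrange (m * (12 + n * 9)) (n * 9) t ⟩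
        1 + suc m * (12 + n * 9) + t                       ∎
        where
        open ≤-Reasoning
        rearrange : ∀ x y t → 1 + x + (7 + (1 + y + (4 + t))) ≡ 1 + ((12 + y) + x) + t
        rearrange = solve-∀

    module _ (act : Program) (eff : Effect) (performs : Performs act eff) where

      run-lines : ∀ m {pos rem bad p v s j k e a w l t Q} → m + v ≡ n → p ≡ 1 + v * n → bad ≤ 1 + v * n →
        let (bad′ , w′) = foldl eff (bad , w) (lines xs m p v) in
        Σ[ σ ∈ Scratch ] Σ[ t′ ∈ ℕ ] t′ ≤ 1 + m * (12 + n * 9) + t ×
        config (whileNonzero 7 (line act) ∷ Q) (mem pos rem bad (scratch p (14 + v) m s j k e a) xs) w l t ⇝
        config Q (mem pos rem bad′ σ xs) w′ l t′
      run-lines zero eq eqp bad≤ = _ , _ , ≤-refl , tt ▸ stop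
      run-lines (suc m) {bad = bad} {p = p} {v = v} {w = w} {t = t} eq eqp bad≤
        with _ , _ , _ , _ , t₁ , refl , eqt₁ , r₁ ← run-row n {p = p} {s = xs [ v ]} {u = 0} {t = 4 + t}
               (rowStart≤ v eqp (m+v≡n⇒v<n m eq)) (cellStart≤ v) (≤-reflexive (+-identityʳ n))
        with _ , _ , t₂ , t₂≤ , bad₂≤ , r₂ ←
             performs {bad = bad} {v = v} {s = gather xs n p 0 (xs [ v ])} {w = w} {t = t₁}
               (≤-trans (gather-≤ n p 0 (xs [ v ])) (cellStart≤ v)) (m+v≡n⇒v<n m eq) bad≤
        with σ , t₃ , t₃≤ , r₃ ← run-lines m {p = n + p} {v = suc v} {t = t₂}
               (trans (+-suc m v) eq) (trans (cong (n +_) eqp) (+-suc n (v * n))) bad₂≤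
        = σ , t₃ , lineTime m t t₁ t₂ t₃ eqt₁ t₂≤ t₃≤ ,
          tt ▸ tt ▸ tt ▸ (tt , n≤B (n≤1+n n)) ▸ (r₁ ⨾ r₂ ⨾ r₃)

      run-scan : ∀ {pos rem bad σ w l t Q} → bad ≤ 1 →
        let (bad′ , w′) = foldl eff (bad , w) (lines xs n 1 0) in
        Σ[ σ′ ∈ Scratch ] Σ[ t′ ∈ ℕ ] t′ ≤ 4 + n * (12 + n * 9) + t ×
        config (scan act ++ Q) (mem pos rem bad σ xs) w l t ⇝
        config Q (mem pos rem bad′ σ′ xs) w′ l t′
      run-scan {t = t} bad≤
        with σ , t₁ , t₁≤ , r ← run-lines n {v = 0} {t = 3 + t} (+-identityʳ n) refl bad≤
        = σ , t₁ , ≤-trans t₁≤ (≤-reflexive (lem (n * (12 + n * 9)) t)) , tt ▸ tt ▸ (tt , n≤B (n≤1+n n)) ▸ r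
        where
        lem : ∀ x t → 1 + x + (3 + t) ≡ 4 + x + t
        lem = solve-∀

  -- An attempt takes one scan to check and, on success, another to print; 7 covers the other
  -- instructions in either case. After an `emit`, 2 instructions reset the counter. At most n
  -- attempts follow before the next output, and one more `stepCost` pays for the halting test.
  scanCost stepCost maxDelay : ℕ
  scanCost = 4 + n * (12 + n * 9)
  stepCost = 7 + (scanCost + scanCost)
  maxDelay = 2 + suc n * stepCost

  excess : List Bool → ℕ
  excess A = excessOf (lines (cells A) n 1 0)

  labels : List Bool → Word
  labels A = labelsOf (lines (cells A) n 1 0)

  run-check : ∀ A {pos rem bad σ w l t Q} → bad ≤ 1 →
    Σ[ σ′ ∈ Scratch ] Σ[ t′ ∈ ℕ ] t′ ≤ scanCost + t ×
    config (scan check ++ Q) (mem pos rem bad σ (cells A)) w l t ⇝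
    config Q (mem pos rem (excess A + bad) σ′ (cells A)) w l t′
  run-check A {pos} {rem} {bad} {σ} {w} {l} {t} {Q} bad≤
    = let σ′ , t′ , t′≤ , ρ = run-scan (cells A) (cells-≤1 A) check checking (check-performs (cells A) (cells-≤1 A))
           {pos} {rem} {bad} {σ} {w} {l} {t} {Q} bad≤
      in σ′ , t′ , t′≤ ,
         subst (λ (bad′ , w′) → config (scan check ++ Q) (mem pos rem bad σ (cells A)) w l t ⇝
                                config Q (mem pos rem bad′ σ′ (cells A)) w′ l t′)
               (foldl-checking (lines (cells A) n 1 0) bad w) ρ

  run-print : ∀ A {pos rem bad σ w l t Q} → bad ≤ 1 →
    Σ[ σ′ ∈ Scratch ] Σ[ t′ ∈ ℕ ] t′ ≤ scanCost + t ×
    config (scan print ++ Q) (mem pos rem bad σ (cells A)) w l t ⇝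
    config Q (mem pos rem bad σ′ (cells A)) (w ++ labels A) l t′
  run-print A {pos} {rem} {bad} {σ} {w} {l} {t} {Q} bad≤
    = let σ′ , t′ , t′≤ , ρ = run-scan (cells A) (cells-≤1 A) print printing (print-performs (cells A) (cells-≤1 A))
           {pos} {rem} {bad} {σ} {w} {l} {t} {Q} bad≤
      in σ′ , t′ , t′≤ ,
         subst (λ (bad′ , w′) → config (scan print ++ Q) (mem pos rem bad σ (cells A)) w l t ⇝
                                config Q (mem pos rem bad′ σ′ (cells A)) w′ l t′)
               (foldl-printing (lines (cells A) n 1 0) bad w) ρ

  run-announce : ∀ A {pos rem bad σ l t Q} → bad ≤ 1 →
    Σ[ σ′ ∈ Scratch ] Σ[ e ∈ ℕ ] e ≤ 1 + (scanCost + t) ×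
    config (announce ++ Q) (mem pos rem bad σ (cells A)) [] l t ⇝
    config Q (mem 14 n bad σ′ (cells A)) [] (l ++ (e , labels A) ∷ []) (2 + e)
  run-announce A {pos} {rem} {bad} {σ} {l} {t} {Q} bad≤ =
    let σ′ , t′ , t′≤ , ρ = run-print A {pos} {rem} {bad} {σ} {[]} {l} {t} {emit ∷ const 2 14 ∷ add 3 13 0 ∷ Q} bad≤ in
    σ′ , suc t′ , s≤s t′≤ , (ρ ⨾ tt ▸ tt ▸ (tt , n≤B) ▸ stop)
    where
    n≤B : n ≤ B
    n≤B = ≤-trans (m≤m+n n (n * n)) (m≤n+m _ 14)

  atLoop : ℕ → ℕ → ℕ → Scratch → List Bool → List (ℕ × Word) → ℕ → Config
  atLoop i m bad σ A l t = config (whileNonzero 3 attempt ∷ []) (mem (14 + i) m bad σ (cells A)) [] l t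

  run-attempt : ∀ i b V {m bad σ l t} → i < n →
    Σ[ σ′ ∈ Scratch ] Σ[ t′ ∈ ℕ ] t′ ≤ 3 + (scanCost + t) ×
    atLoop i (suc m) bad σ (fill i (b ∷ V)) l t ⇝
    config (ifNonzero 4 advance announce ∷ whileNonzero 3 attempt ∷ [])
      (mem (14 + i) (suc m) (excess (fill i (true ∷ V)) + bit b) σ′ (cells (fill i (true ∷ V)))) [] l t′
  run-attempt i b V {m} {bad} {σ} {l} {t} i<n
    = let σ′ , t′ , t′≤ , ρ = run-check (fill i (true ∷ V)) {14 + i} {suc m} {bit b} {σ} {[]} {l} {3 + t}
                                 {ifNonzero 4 advance announce ∷ whileNonzero 3 attempt ∷ []} (bit-≤1 b) in
      σ′ , t′ , ≤-trans t′≤ (≤-reflexive (trans (+-comm scanCost (3 + t)) (cong (3 +_) (+-comm t scanCost)))) ,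
      (subst₂ (λ x xs → atLoop i (suc m) bad σ (fill i (b ∷ V)) l t ⇝
                config (scan check ++ ifNonzero 4 advance announce ∷ whileNonzero 3 attempt ∷ [])
                       (mem (14 + i) (suc m) x σ xs) [] l (3 + t))
              loaded stored (set-cell (cells (fill i (b ∷ V))))
       ⨾ ρ)
    where
    -- For a variable `xs` the lookup and the update stay symbolic, so the trace holds by
    -- evaluation; `loaded` and `stored` are substituted afterwards.
    set-cell : ∀ xs →
      config (whileNonzero 3 attempt ∷ []) (mem (14 + i) (suc m) bad σ xs) [] l t ⇝
      config (scan check ++ ifNonzero 4 advance announce ∷ whileNonzero 3 attempt ∷ [])
             (mem (14 + i) (suc m) (xs [ i ]) σ (xs [ i ]≔ 1)) [] l (3 + t)
    set-cell xs = tt ▸ tt ▸ +-monoʳ-< 14 i<n ▸ stop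
    loaded : cells (fill i (b ∷ V)) [ i ] ≡ bit b
    loaded = trans (cong (cells (fill i (b ∷ V)) [_]) (sym (+-identityʳ i))) (fill-lookup i (b ∷ V) 0)
    stored : cells (fill i (b ∷ V)) [ i ]≔ 1 ≡ cells (fill i (true ∷ V))
    stored = trans (cong (cells (fill i (b ∷ V)) [_]≔ 1) (sym (+-identityʳ i)))
                   (fill-update i (b ∷ V) 0 1 (true ∷ V) refl)

  afterCheck : ℕ → ℕ → ℕ → Scratch → List Bool → List (ℕ × Word) → ℕ → Config
  afterCheck i m bad σ A l t =
    config (ifNonzero 4 advance announce ∷ whileNonzero 3 attempt ∷ []) (mem (14 + i) m bad σ (cells A)) [] l t

  run-advance : ∀ i b V {m bad σ l t} → i < n → 0 < bad →
    afterCheck i (suc m) bad σ (fill i (b ∷ V)) l t ⇝ atLoop (suc i) m bad σ (fill (suc i) V) l (4 + t)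
  run-advance i b V {m} {suc k} {σ} {l} {t} i<n _ =
    subst (λ xs → afterCheck i (suc m) (suc k) σ (fill i (b ∷ V)) l t ⇝
                  config (whileNonzero 3 attempt ∷ []) (mem (15 + i) m (suc k) σ xs) [] l (4 + t))
          cleared (clear-cell (cells (fill i (b ∷ V))))
    where
    clear-cell : ∀ xs →
      config (ifNonzero 4 advance announce ∷ whileNonzero 3 attempt ∷ []) (mem (14 + i) (suc m) (suc k) σ xs) [] l t ⇝
      config (whileNonzero 3 attempt ∷ []) (mem (15 + i) m (suc k) σ (xs [ i ]≔ 0)) [] l (4 + t)
    clear-cell xs = tt ▸ +-monoʳ-< 14 i<n ▸
      (tt , ≤-trans (+-monoʳ-≤ 14 i<n) (+-monoʳ-≤ 14 (m≤m+n n (n * n)))) ▸ tt ▸ stop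
    cleared : cells (fill i (b ∷ V)) [ i ]≔ 0 ≡ cells (fill i (false ∷ V))
    cleared = trans (cong (cells (fill i (b ∷ V)) [_]≔ 0) (sym (+-identityʳ i)))
                    (fill-update i (b ∷ V) 0 0 (false ∷ V) refl)

  -- Both reasons to leave a position, an old 1 and a failed check, make the outcome positive and
  -- are treated alike.
  run-failure : ∀ i b V {m bad σ l t} → i < n → 0 < excess (fill i (true ∷ V)) + bit b →
    Σ[ bad′ ∈ ℕ ] Σ[ σ′ ∈ Scratch ] Σ[ t′ ∈ ℕ ] t′ ≤ stepCost + t ×
    atLoop i (suc m) bad σ (fill i (b ∷ V)) l t ⇝ atLoop (suc i) m bad′ σ′ (fill (suc i) V) l t′
  run-failure i b V {m} {bad} {σ} {l} {t} i<n excess>0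
    = let σ′ , t′ , t′≤ , ρ = run-attempt i b V {m} {bad} {σ} {l} {t} i<n in
      excess (fill i (true ∷ V)) + bit b , σ′ , 4 + t′ ,
      ≤-trans (+-monoʳ-≤ 4 t′≤) (+-monoʳ-≤ 7 (+-monoˡ-≤ t (m≤m+n scanCost scanCost))) ,
      (ρ ⨾ run-advance i true V {m} {excess (fill i (true ∷ V)) + bit b} {σ′} {l} {t′} i<n excess>0)

  run-accept : ∀ i A {m bad σ l t} → bad ≡ 0 →
    Σ[ σ′ ∈ Scratch ] Σ[ e ∈ ℕ ] e ≤ 2 + (scanCost + t) ×
    afterCheck i m bad σ A l t ⇝ atLoop 0 n 0 σ′ A (l ++ (e , labels A) ∷ []) (2 + e)
  run-accept i A {m} {σ = σ} {l} {t} refl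
    = let σ′ , e , e≤ , ρ = run-announce A {14 + i} {m} {0} {σ} {l} {suc t} {whileNonzero 3 attempt ∷ []} z≤n in
      σ′ , e , ≤-trans e≤ (s≤s (≤-reflexive (+-suc scanCost t))) , tt ▸ ρ

  run-success : ∀ i V {m bad σ l t} → i < n → excess (fill i (true ∷ V)) ≡ 0 →
    Σ[ σ′ ∈ Scratch ] Σ[ e ∈ ℕ ] e ≤ stepCost + t ×
    atLoop i (suc m) bad σ (fill i (false ∷ V)) l t ⇝
    atLoop 0 n 0 σ′ (fill i (true ∷ V)) (l ++ (e , labels (fill i (true ∷ V))) ∷ []) (2 + e)
  run-success i V {m} {bad} {σ} {l} {t} i<n excess≡0
    = let σ₁ , t₁ , t₁≤ , ρ₁ = run-attempt i false V {m} {bad} {σ} {l} {t} i<n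
          σ₂ , e , e≤ , ρ₂ = run-accept i (fill i (true ∷ V)) {suc m} {excess (fill i (true ∷ V)) + 0} {σ₁} {l} {t₁}
                               (trans (+-identityʳ _) excess≡0)
      in σ₂ , e , time t₁ e t₁≤ e≤ , (ρ₁ ⨾ ρ₂)
    where
    open ≤-Reasoning
    rearrange : ∀ x t → 2 + (x + (3 + (x + t))) ≡ 5 + (x + x + t)
    rearrange = solve-∀
    time : ∀ t₁ e → t₁ ≤ 3 + (scanCost + t) → e ≤ 2 + (scanCost + t₁) → e ≤ stepCost + t
    time t₁ e t₁≤ e≤ = begin
      e                                       ≤⟨ e≤ ⟩
      2 + (scanCost + t₁)                     ≤⟨ +-monoʳ-≤ 2 (+-monoʳ-≤ scanCost t₁≤) ⟩
      2 + (scanCost + (3 + (scanCost + t)))   ≡⟨ rearrange scanCost t ⟩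
      5 + (scanCost + scanCost + t)           ≤⟨ m≤n+m _ 2 ⟩
      stepCost + t                            ∎

  -- The packings output after fill i V that agree with V from position i on.
  later : ℕ → List Bool → List (List Bool)
  later zero    V = []
  later (suc i) V = later i (false ∷ V) ++
    (ifZero excess (fill i (true ∷ V)) then fill i (true ∷ V) ∷ later i (true ∷ V) else [])

  Paced-log : List (ℕ × Word) → ℕ → Set
  Paced-log l s = Paced maxDelay (map proj₁ l) s

  -- The counter arrives at position i having output `new`. At most i attempts have failed since the
  -- latest output at time s, whence the bound on the clock.
  Reaches : Config → List (ℕ × Word) → ℕ → ℕ → List Bool → List (List Bool) → Set
  Reaches c l i m A new =
    Σ[ bad ∈ ℕ ] Σ[ σ ∈ Scratch ] Σ[ l′ ∈ List (ℕ × Word) ] Σ[ t ∈ ℕ ] Σ[ s ∈ ℕ ]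
    Paced-log l′ s × t ≤ s + (2 + i * stepCost) × map proj₂ l′ ≡ map proj₂ l ++ map labels new ×
    c ⇝ atLoop i m bad σ A l′ t

  Paced-snoc : ∀ l {s e} w → Paced-log l s → e ≤ s + maxDelay → Paced-log (l ++ (e , w) ∷ []) e
  Paced-snoc l w paced e≤ = subst (λ ts → Paced maxDelay ts _) (sym (map-++ proj₁ l _)) (output paced e≤)

  add-stepCost : ∀ {t t′ s} i → t ≤ s + (2 + i * stepCost) → t′ ≤ stepCost + t → t′ ≤ s + (2 + suc i * stepCost)
  add-stepCost {t} {t′} {s} i t≤ t′≤ = begin
    t′                                    ≤⟨ t′≤ ⟩
    stepCost + t                          ≤⟨ +-monoʳ-≤ stepCost t≤ ⟩
    stepCost + (s + (2 + i * stepCost))   ≡⟨ rearrange stepCost s (i * stepCost) ⟩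
    s + (2 + suc i * stepCost)            ∎
    where
    open ≤-Reasoning
    rearrange : ∀ x s y → x + (s + (2 + y)) ≡ s + (2 + (x + y))
    rearrange = solve-∀

  ≤maxDelay : ∀ {t s} i → i ≤ n → t ≤ s + (2 + suc i * stepCost) → t ≤ s + maxDelay
  ≤maxDelay {s = s} i i≤n t≤ = ≤-trans t≤ (+-monoʳ-≤ s (+-monoʳ-≤ 2 (*-monoˡ-≤ stepCost (s≤s i≤n))))

  -- Binary counting by induction on i: sweep the lower positions with bit i equal to 0, then
  -- attempt bit i. If this succeeds, the counter restarts and sweeps the lower positions again with
  -- bit i equal to 1; afterwards that 1 forces a failure. Either way the counter leaves position i
  -- with all positions up to i cleared.
  enumerate : ∀ i V {bad σ l t s} → i + length V ≡ n → Paced-log l s → t ≤ s + 2 →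
    Reaches (atLoop 0 n bad σ (fill i V) l t) l i (length V) (fill i V) (later i V)
  enumerate zero V {l = l} refl paced t≤ =
    _ , _ , l , _ , _ , paced , t≤ , sym (++-identityʳ _) , stop
  enumerate (suc i) V {bad} {σ} {l} {t} {s} eq paced t≤ =
    branch (excess (fill i (true ∷ V))) refl (enumerate i (false ∷ V) i+ paced t≤)
    where
    i+ : i + suc (length V) ≡ n
    i+ = trans (+-suc i _) eq
    i<n : i < n
    i<n = subst (i <_) eq (s≤s (m≤m+n i _))
    c = atLoop 0 n bad σ (fill (suc i) V) l t
    -- Abstracting the excess to `e` makes the `ifZero` inside `later` reduce in each case.
    branch : ∀ e → excess (fill i (true ∷ V)) ≡ e →
      Reaches c l i (suc (length V)) (fill (suc i) V) (later i (false ∷ V)) →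
      Reaches c l (suc i) (length V) (fill (suc i) V)
        (later i (false ∷ V) ++ (ifZero e then fill i (true ∷ V) ∷ later i (true ∷ V) else []))
    branch (suc e) eqe (bad₁ , σ₁ , l₁ , t₁ , s₁ , paced₁ , t₁≤ , l₁≡ , ρ₁) =
      let bad₂ , σ₂ , t₂ , t₂≤ , ρ₂ = run-failure i false V {length V} {bad₁} {σ₁} {l₁} {t₁} i<n
            (subst (λ x → 0 < x + 0) (sym eqe) (s≤s z≤n))
      in bad₂ , σ₂ , l₁ , t₂ , s₁ , paced₁ , add-stepCost i t₁≤ t₂≤ ,
         trans l₁≡ (cong (λ ws → map proj₂ l ++ map labels ws) (sym (++-identityʳ _))) ,
         (ρ₁ ⨾ ρ₂)
    branch zero eqe (bad₁ , σ₁ , l₁ , t₁ , s₁ , paced₁ , t₁≤ , l₁≡ , ρ₁) =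
      let σ₂ , e , e≤ , ρ₂ = run-success i V {length V} {bad₁} {σ₁} {l₁} {t₁} i<n eqe
          l₂ = l₁ ++ (e , labels (fill i (true ∷ V))) ∷ []
          paced₂ = Paced-snoc l₁ (labels (fill i (true ∷ V))) paced₁ (≤maxDelay i (<⇒≤ i<n) (add-stepCost i t₁≤ e≤))
          bad₃ , σ₃ , l₃ , t₃ , s₃ , paced₃ , t₃≤ , l₃≡ , ρ₃ =
            enumerate i (true ∷ V) {0} {σ₂} {l₂} {2 + e} {e} i+ paced₂ (≤-reflexive (+-comm 2 e))
          bad₄ , σ₄ , t₄ , t₄≤ , ρ₄ = run-failure i true V {length V} {bad₃} {σ₃} {l₃} {t₃} i<n
            (m≤n+m 1 (excess (fill i (true ∷ V))))
      in bad₄ , σ₄ , l₃ , t₄ , s₃ , paced₃ , add-stepCost i t₃≤ t₄≤ , outputs≡ l₁ l₃ e l₁≡ l₃≡ ,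
         (ρ₁ ⨾ ρ₂ ⨾ ρ₃ ⨾ ρ₄)
      where
      open ≡-Reasoning
      A = fill i (true ∷ V)
      outputs≡ : ∀ l₁ l₃ e → map proj₂ l₁ ≡ map proj₂ l ++ map labels (later i (false ∷ V)) →
        map proj₂ l₃ ≡ map proj₂ (l₁ ++ (e , labels A) ∷ []) ++ map labels (later i (true ∷ V)) →
        map proj₂ l₃ ≡ map proj₂ l ++ map labels (later i (false ∷ V) ++ A ∷ later i (true ∷ V))
      outputs≡ l₁ l₃ e l₁≡ l₃≡ = begin
        map proj₂ l₃
          ≡⟨ l₃≡ ⟩
        map proj₂ (l₁ ++ (e , labels A) ∷ []) ++ map labels (later i (true ∷ V))
          ≡⟨ cong (_++ map labels (later i (true ∷ V))) (map-++ proj₂ l₁ _) ⟩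
        (map proj₂ l₁ ++ labels A ∷ []) ++ map labels (later i (true ∷ V))
          ≡⟨ ++-assoc (map proj₂ l₁) _ _ ⟩
        map proj₂ l₁ ++ map labels (A ∷ later i (true ∷ V))
          ≡⟨ cong (_++ map labels (A ∷ later i (true ∷ V))) l₁≡ ⟩
        (map proj₂ l ++ map labels (later i (false ∷ V))) ++ map labels (A ∷ later i (true ∷ V))
          ≡⟨ ++-assoc (map proj₂ l) _ _ ⟩
        map proj₂ l ++ (map labels (later i (false ∷ V)) ++ map labels (A ∷ later i (true ∷ V)))
          ≡⟨ cong (map proj₂ l ++_) (map-++ labels (later i (false ∷ V)) _) ⟨
        map proj₂ l ++ map labels (later i (false ∷ V) ++ A ∷ later i (true ∷ V)) ∎

  -- Initialisation and the complete run

  fill-false : ∀ i V → fill i (false ∷ V) ≡ false ∷ fill i V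
  fill-false zero    V = refl
  fill-false (suc i) V = fill-false i (false ∷ V)

  extend-empty : ∀ k → [] [ k ]≔ 0 ≡ cells (fill (suc k) [])
  extend-empty zero    = refl
  extend-empty (suc k) = trans (cong (0 ∷_) (extend-empty k)) (cong cells (sym (fill-false k (false ∷ []))))

  run-initialise : I [ 0 ] ≡ n → Σ[ σ ∈ Scratch ]
    config program [] [] [] 0 ⇝
    config (announce ++ whileNonzero 3 attempt ∷ []) (mem (13 + n) 0 0 σ (cells (fill n []))) [] [] 6
  run-initialise eq = blank , subst (λ m → config program [] [] [] 0 ⇝
                                      config (announce ++ whileNonzero 3 attempt ∷ []) m [] [] 6)
                                (extended (I [ 0 ]) eq) raw
    where
    blank : Scratch
    blank = scratch 0 0 0 0 0 0 0 0
    m₀ : ℕ → Memory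
    m₀ k = k ∷ 1 ∷ 13 + k ∷ 0 ∷ 0 ∷ 0 ∷ 0 ∷ 0 ∷ 0 ∷ 0 ∷ 0 ∷ 0 ∷ 0 ∷ 0 ∷ []
    extended : ∀ k → k ≡ n → m₀ k [ 13 + k ]≔ 0 ≡ mem (13 + n) 0 0 blank (cells (fill n []))
    extended zero    refl = refl
    extended (suc k) refl = cong (λ xs → m₀ n ++ xs) (extend-empty k)
    raw : config program [] [] [] 0 ⇝
          config (announce ++ whileNonzero 3 attempt ∷ []) (m₀ (I [ 0 ]) [ 13 + I [ 0 ] ]≔ 0) [] [] 6
    raw = tt ▸ tt ▸ tt ▸ (tt , subst (λ k → 13 + k ≤ B) (sym eq) (+-mono-≤ (n≤1+n 13) (m≤m+n n (n * n)))) ▸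
          tt ▸ subst (λ k → 13 + k < L) (sym eq) ≤-refl ▸ stop

  -- The announcement before the loop outputs the empty packing `fill n []`; the loop contributes
  -- the others.
  run-program : I [ 0 ] ≡ n → Σ[ c ∈ Config ] config program [] [] [] 0 ⇝ c × Halted c ×
    outputs c ≡ map labels (fill n [] ∷ later n []) ×
    Σ[ s ∈ ℕ ] Paced-log (log c) s × clock c ≤ s + maxDelay
  run-program eq =
    let σ₀ , ρ₀ = run-initialise eq
        σ₁ , e , e≤ , ρ₁ = run-announce (fill n []) {13 + n} {0} {0} {σ₀} {[]} {6} {whileNonzero 3 attempt ∷ []} z≤n
        bad₂ , σ₂ , l₂ , t₂ , s₂ , paced₂ , t₂≤ , l₂≡ , ρ₂ =
          enumerate n [] {0} {σ₁} {(e , labels (fill n [])) ∷ []} {2 + e} {e} (+-identityʳ n)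
            (output start (first e e≤)) (≤-reflexive (+-comm 2 e))
    in config [] (mem (14 + n) 0 bad₂ σ₂ (cells (fill n []))) [] l₂ (suc t₂) ,
       (ρ₀ ⨾ ρ₁ ⨾ ρ₂ ⨾ tt ▸ stop) , refl , l₂≡ , s₂ , paced₂ ,
       -- The final loop test is charged as a further attempt after n failed ones.
       ≤maxDelay n ≤-refl (add-stepCost n t₂≤ (s≤s (m≤n+m t₂ _)))
    where
    first : ∀ e → e ≤ 1 + (scanCost + 6) → e ≤ maxDelay
    first e e≤ = ≤-trans e≤ (≤-trans (≤-reflexive (cong suc (+-comm scanCost 6)))
      (≤-trans (+-monoʳ-≤ 7 (m≤m+n scanCost scanCost)) (≤-trans (m≤m+n stepCost (n * stepCost)) (m≤n+m _ 2))))

-- Packings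

∑ : ∀ {n} → (Fin n → ℕ) → ℕ
∑ g = sum (tabulate g)

∑-mono-≤ : ∀ {n} {g h : Fin n → ℕ} → (∀ i → g i ≤ h i) → ∑ g ≤ ∑ h
∑-mono-≤ {zero}  g≤h = z≤n
∑-mono-≤ {suc n} g≤h = +-mono-≤ (g≤h zero) (∑-mono-≤ (g≤h ∘ suc))

∑-zero : ∀ {n} {g : Fin n → ℕ} → (∀ i → g i ≡ 0) → ∑ g ≡ 0
∑-zero {zero}  g≡0 = refl
∑-zero {suc n} g≡0 = cong₂ _+_ (g≡0 zero) (∑-zero (g≡0 ∘ suc))

term≤∑ : ∀ {n} (g : Fin n → ℕ) i → g i ≤ ∑ g
term≤∑ g zero    = m≤m+n _ _
term≤∑ g (suc i) = ≤-trans (term≤∑ (g ∘ suc) i) (m≤n+m _ (g zero))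

two-terms≤∑ : ∀ {n} (g : Fin n → ℕ) {i j} → i ≢ j → g i + g j ≤ ∑ g
two-terms≤∑ g {zero}  {zero}  i≢j = contradiction refl i≢j
two-terms≤∑ g {zero}  {suc j} i≢j = +-monoʳ-≤ (g zero) (term≤∑ (g ∘ suc) j)
two-terms≤∑ g {suc i} {zero}  i≢j =
  ≤-trans (≤-reflexive (+-comm (g (suc i)) _)) (+-monoʳ-≤ (g zero) (term≤∑ (g ∘ suc) i))
two-terms≤∑ g {suc i} {suc j} i≢j =
  ≤-trans (two-terms≤∑ (g ∘ suc) (i≢j ∘ cong suc)) (m≤n+m _ (g zero))

∑>0⇒term>0 : ∀ {n} (g : Fin n → ℕ) → 0 < ∑ g → ∃ λ i → 0 < g i
∑>0⇒term>0 {suc n} g ∑>0 with g zero in eq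
... | suc _ = zero , subst (0 <_) (sym eq) (s≤s z≤n)
... | zero with i , gi>0 ← ∑>0⇒term>0 (g ∘ suc) ∑>0 = suc i , gi>0

∑≤1 : ∀ {n} (g : Fin n → ℕ) → (∀ i → g i ≤ 1) → (∀ i j → 0 < g i → 0 < g j → i ≡ j) → ∑ g ≤ 1
∑≤1 {zero}  g g≤1 unique = z≤n
∑≤1 {suc n} g g≤1 unique with g zero in eq
... | zero  = ∑≤1 (g ∘ suc) (g≤1 ∘ suc) (λ i j p q → Fin.suc-injective (unique (suc i) (suc j) p q))
... | suc k with ∑ (g ∘ suc) in eq′
...   | zero  = ≤-trans (≤-reflexive (trans (+-identityʳ _) (sym eq))) (g≤1 zero)
...   | suc _ with i , gi>0 ← ∑>0⇒term>0 (g ∘ suc) (subst (0 <_) (sym eq′) (s≤s z≤n))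
              with () ← unique zero (suc i) (subst (0 <_) (sym eq) (s≤s z≤n)) gi>0

module PackingTheory {n} (G : Graph n) where
  open Graph G using (adj; _~_)

  -- A set of vertices is given by its characteristic function a.  The set
  -- is a packing if all closed neighbourhoods meet it in at most one vertex.
  response : (Fin n → ℕ) → Fin n → Fin n → ℕ
  response a v u = a u ∸ (1 ∸ bit (adj v u))

  closedSum : (Fin n → ℕ) → Fin n → ℕ
  closedSum a v = ∑ (response a v) + a v

  Packing : (Fin n → ℕ) → Set
  Packing a = ∀ v → closedSum a v ≤ 1

  label : (Fin n → ℕ) → Fin n → ℕ
  label a v = 1 + (a v + a v) ∸ closedSum a v

  Near : Fin n → Fin n → Set
  Near c u = c ≡ u ⊎ c ~ u

  response-~ : ∀ a {v u} → v ~ u → response a v u ≡ a u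
  response-~ a {v} {u} v~u rewrite v~u = refl

  response>0 : ∀ a {v u} → a u ≤ 1 → 0 < response a v u → v ~ u × a u ≡ 1
  response>0 a {v} {u} au≤1 r>0 with adj v u | a u | au≤1
  ... | true  | suc zero | s≤s z≤n = refl , refl
  ... | false | suc zero | s≤s z≤n = contradiction r>0 λ ()
  ... | false | zero     | z≤n     = contradiction r>0 λ ()

  response≤ : ∀ a v u → response a v u ≤ a u
  response≤ a v u = m∸n≤m (a u) (1 ∸ bit (adj v u))

  ∅-packing : ∀ {a} → (∀ v → a v ≡ 0) → Packing a
  ∅-packing {a} a≡0 v = ≤-trans (≤-reflexive (cong₂ _+_
    (∑-zero λ u → n≤0⇒n≡0 (subst (response a v u ≤_) (a≡0 u) (response≤ a v u))) (a≡0 v))) z≤n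

  Packing-anti : ∀ {a b} → (∀ v → a v ≤ b v) → Packing b → Packing a
  Packing-anti a≤b packing v =
    ≤-trans (+-mono-≤ (∑-mono-≤ λ u → ∸-monoˡ-≤ (1 ∸ bit (adj v u)) (a≤b u)) (a≤b v)) (packing v)

  private
    ¬2≤1 : ∀ {k} → 2 ≤ k → k ≤ 1 → ⊥
    ¬2≤1 p q = contradiction (≤-trans p q) λ where (s≤s ())

  -- Two different elements in the closed neighbourhood of c would bring the closed sum at c to 2;
  -- the centre enters through `a c`, neighbours through `response`.
  packing-near : ∀ {a c u u′} → Packing a → Near c u → Near c u′ → 0 < a u → 0 < a u′ → u ≡ u′
  packing-near packing (inj₁ refl) (inj₁ refl) au>0 au′>0 = refl
  packing-near {a} {c} {u} {u′} packing (inj₁ refl) (inj₂ c~u′) au>0 au′>0 =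
    ⊥-elim (¬2≤1 (+-mono-≤ (≤-trans (≤-trans au′>0 (≤-reflexive (sym (response-~ a c~u′))))
                               (term≤∑ (response a c) u′)) au>0)
                 (packing c))
  packing-near {a} {c} {u} {u′} packing (inj₂ c~u) (inj₁ refl) au>0 au′>0 =
    sym (packing-near {a} packing (inj₁ refl) (inj₂ c~u) au′>0 au>0)
  packing-near {a} {c} {u} {u′} packing (inj₂ c~u) (inj₂ c~u′) au>0 au′>0 with u Fin.≟ u′
  ... | yes u≡u′ = u≡u′
  ... | no  u≢u′ = ⊥-elim (¬2≤1
    (≤-trans (+-mono-≤ (≤-trans au>0 (≤-reflexive (sym (response-~ a c~u))))
                       (≤-trans au′>0 (≤-reflexive (sym (response-~ a c~u′)))))
             (two-terms≤∑ (response a c) u≢u′))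
    (≤-trans (m≤m+n _ (a c)) (packing c)))

  -- The possible values of a v, the number of neighbours of v in a, and label a v.
  data Status : ℕ → ℕ → ℕ → Set where
    chosen    : Status 1 0 2
    dominated : Status 0 1 0
    free      : Status 0 0 1

  status : ∀ x r → r + x ≤ 1 → Status x r (1 + (x + x) ∸ (r + x))
  status zero          zero          _ = free
  status (suc zero)    zero          _ = chosen
  status zero          (suc zero)    _ = dominated
  status (suc (suc x)) zero          (s≤s ())
  status zero          (suc (suc r)) (s≤s ())
  status (suc x)       (suc r)       (s≤s p) with () ← subst (_≤ 0) (+-suc r x) p

  Status⇒≤2 : ∀ {x r k} → Status x r k → k < 3
  Status⇒≤2 chosen    = ≤-refl
  Status⇒≤2 dominated = s≤s z≤n
  Status⇒≤2 free      = s≤s (s≤s z≤n)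

  statusAt : ∀ {a} → Packing a → ∀ v → Status (a v) (∑ (response a v)) (label a v)
  statusAt {a} packing v = status (a v) (∑ (response a v)) (packing v)

  -- The three statuses have different labels, so the label reveals membership.
  label-injective : ∀ {a b} → Packing a → Packing b → ∀ v → label a v ≡ label b v → a v ≡ b v
  label-injective {a} {b} pa pb v eq = determined (statusAt pa v) (statusAt pb v) eq
    where
    determined : ∀ {x y r s k l} → Status x r k → Status y s l → k ≡ l → x ≡ y
    determined chosen    chosen    _ = refl
    determined dominated dominated _ = refl
    determined free      free      _ = refl

  toFunction : ∀ {a} → Packing a → Fin n → Fin 3
  toFunction packing v = fromℕ< (Status⇒≤2 (statusAt packing v))

  toℕ-toFunction : ∀ {a} (packing : Packing a) v → toℕ (toFunction packing v) ≡ label a v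
  toℕ-toFunction packing v = Fin.toℕ-fromℕ< _

  -- Label 2 marks the elements of the packing. By `Status`, label 0 means one neighbour in the
  -- packing and labels 1 and 2 mean none.
  packing⇒URRDF : ∀ {a} (packing : Packing a) → IsURRDF G (toFunction packing)
  packing⇒URRDF {a} packing = record
    { unique-response = λ v fv≡0 → responder v (trans (sym (toℕ-toFunction packing v)) fv≡0)
    ; no-response     = λ v fv≥1 (u , v~u , fu≡2) →
        silent (statusAt packing v) (subst (1 ≤_) (toℕ-toFunction packing v) fv≥1)
          (≤-trans (≤-reflexive (sym (trans (response-~ a v~u) (label≡2⇒chosen u fu≡2)))) (term≤∑ (response a v) u))
    }
    where
    a≤1 : ∀ v → a v ≤ 1
    a≤1 v = ≤-trans (m≤n+m _ _) (packing v)
    chosen⁻ : ∀ {x r k} → Status x r k → k ≡ 2 → x ≡ 1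
    chosen⁻ chosen _ = refl
    chosen⁺ : ∀ {x r k} → Status x r k → x ≡ 1 → k ≡ 2
    chosen⁺ chosen _ = refl
    dominated⁻ : ∀ {x r k} → Status x r k → k ≡ 0 → r ≡ 1
    dominated⁻ dominated _ = refl
    silent : ∀ {x r k} → Status x r k → 1 ≤ k → 1 ≤ r → ⊥
    silent dominated () _
    label≡2⇒chosen : ∀ u → toℕ (toFunction packing u) ≡ 2 → a u ≡ 1
    label≡2⇒chosen u fu≡2 = chosen⁻ (statusAt packing u) (trans (sym (toℕ-toFunction packing u)) fu≡2)
    responder : ∀ v → label a v ≡ 0 → ∃! _≡_ (λ u → v ~ u × toℕ (toFunction packing u) ≡ 2)
    responder v lv≡0
      with u , r>0 ← ∑>0⇒term>0 (response a v) (≤-reflexive (sym (dominated⁻ (statusAt packing v) lv≡0)))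
      with v~u , au≡1 ← response>0 a (a≤1 u) r>0 =
      u , (v~u , trans (toℕ-toFunction packing u) (chosen⁺ (statusAt packing u) au≡1)) ,
      λ {u′} (v~u′ , fu′≡2) → packing-near {a} packing (inj₂ v~u) (inj₂ v~u′)
        (≤-reflexive (sym au≡1)) (≤-reflexive (sym (label≡2⇒chosen u′ fu′≡2)))

  -- From response functions back to packings

  isTwo : Fin 3 → Bool
  isTwo zero             = false
  isTwo (suc zero)       = false
  isTwo (suc (suc zero)) = true

  module FromURRDF {f : Fin n → Fin 3} (urrdf : IsURRDF G f) where
    open IsURRDF urrdf

    twos : Fin n → ℕ
    twos v = bit (isTwo (f v))

    isTwo⇒2 : ∀ x → bit (isTwo x) ≡ 1 → toℕ x ≡ 2
    isTwo⇒2 (suc (suc zero)) _ = refl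

    2⇒isTwo : ∀ x → toℕ x ≡ 2 → bit (isTwo x) ≡ 1
    2⇒isTwo (suc (suc zero)) _ = refl

    responder : ∀ v u → 0 < response twos v u → v ~ u × toℕ (f u) ≡ 2
    responder v u r>0 with v~u , t ← response>0 twos (bit-≤1 (isTwo (f u))) r>0 = v~u , isTwo⇒2 (f u) t

    responses≡0 : ∀ v → 1 ≤ toℕ (f v) → ∑ (response twos v) ≡ 0
    responses≡0 v fv≥1 with ∑ (response twos v) in eq
    ... | zero  = refl
    ... | suc _ with u , r>0 ← ∑>0⇒term>0 (response twos v) (subst (0 <_) (sym eq) (s≤s z≤n)) =
      ⊥-elim (no-response v fv≥1 (u , responder v u r>0))

    responses≡1 : ∀ v → toℕ (f v) ≡ 0 → ∑ (response twos v) ≡ 1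
    responses≡1 v fv≡0 with u , (v~u , fu≡2) , unique ← unique-response v fv≡0 =
      ≤-antisym
        (∑≤1 (response twos v) (λ i → ≤-trans (response≤ twos v i) (bit-≤1 _))
          λ i j p q → trans (sym (unique (responder v i p))) (unique (responder v j q)))
        (≤-trans (≤-reflexive (sym (trans (response-~ twos v~u) (2⇒isTwo (f u) fu≡2)))) (term≤∑ (response twos v) u))

    -- The two defining conditions prescribe one neighbour of value 2 where `f` is 0 and none
    -- elsewhere. The packing property and the recovery of `f` are then read off from the status.
    twos-status : ∀ v → Status (twos v) (∑ (response twos v)) (toℕ (f v))
    twos-status v = go (f v) (responses≡0 v) (responses≡1 v)
      where
      go : ∀ x {r} → (1 ≤ toℕ x → r ≡ 0) → (toℕ x ≡ 0 → r ≡ 1) → Status (bit (isTwo x)) r (toℕ x)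
      go zero             _  p rewrite p refl       = dominated
      go (suc zero)       p  _ rewrite p (s≤s z≤n)  = free
      go (suc (suc zero)) p  _ rewrite p (s≤s z≤n)  = chosen

    twos-packing : Packing twos
    twos-packing v = bound (twos-status v)
      where
      bound : ∀ {x r k} → Status x r k → r + x ≤ 1
      bound chosen    = ≤-refl
      bound dominated = ≤-refl
      bound free      = z≤n

    label-twos : ∀ v → label twos v ≡ toℕ (f v)
    label-twos v = same (twos-status v)
      where
      same : ∀ {x r k} → Status x r k → 1 + (x + x) ∸ (r + x) ≡ k
      same chosen    = refl
      same dominated = refl
      same free      = refl

-- Spanning star forests

module _ {A : Set} where

  Unique-resp-↭ : {xs ys : List A} → xs ↭ ys → Unique xs → Unique ys
  Unique-resp-↭ = SetoidPerm.Unique-resp-↭ (setoid A) ∘ ↭⇒↭ₛ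

  Unique-⊆⇒length-≤ : {xs ys : List A} → Unique xs → (∀ {x} → x ∈ xs → x ∈ ys) → length xs ≤ length ys
  Unique-⊆⇒length-≤ []            xs⊆ys = z≤n
  Unique-⊆⇒length-≤ {x ∷ xs} (x∉xs ∷ unique) xs⊆ys
    with as , bs , refl ← ∈-∃++ (xs⊆ys (here refl)) =
    ≤-trans (s≤s (Unique-⊆⇒length-≤ unique λ {y} y∈xs → skip y∈xs (∈-resp-↭ (shift x as bs) (xs⊆ys (there y∈xs)))))
            (≤-reflexive (sym (Perm.↭-length (shift x as bs))))
    where
    skip : ∀ {y} → y ∈ xs → y ∈ x ∷ as ++ bs → y ∈ as ++ bs
    skip y∈xs (here refl) = contradiction refl (All.lookup x∉xs y∈xs)
    skip y∈xs (there y∈)  = y∈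

  Unique-map : {B : Set} {f : A → B} {P : A → Set} {xs : List A} → All P xs →
    (∀ {x y} → P x → P y → f x ≡ f y → x ≡ y) → Unique xs → Unique (map f xs)
  Unique-map []         inj []              = []
  Unique-map (px ∷ pxs) inj (x∉xs ∷ unique) =
    All.map⁺ (All.zipWith (λ (x≢y , py) fx≡fy → x≢y (inj px py fx≡fy)) (x∉xs , pxs)) ∷ Unique-map pxs inj unique

  length-cartesianProductWith : {B C : Set} (f : A → B → C) (xs : List A) (ys : List B) →
    length (cartesianProductWith f xs ys) ≡ length xs * length ys
  length-cartesianProductWith f []       ys = refl
  length-cartesianProductWith f (x ∷ xs) ys = trans (length-++ (map (f x) ys))
    (cong₂ _+_ (length-map (f x) ys) (length-cartesianProductWith f xs ys))

square-* : ∀ x y → (x * y) ^ 2 ≡ x ^ 2 * y ^ 2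
square-* x y = expanded x y
  where
  expanded : ∀ x y → x * y * (x * y * 1) ≡ x * (x * 1) * (y * (y * 1))
  expanded = solve-∀

-- A star with 2 + k vertices meets a packing in one of 3 + k ways: in no vertex or in a single one.
-- Equality holds for a single edge, the source of the base √3.
square-≤ : ∀ k → (3 + k) ^ 2 ≤ 3 ^ (2 + k)
square-≤ zero    = ≤-refl
square-≤ (suc k) = begin
  (4 + k) ^ 2               ≡⟨ cong ((4 + k) *_) (*-identityʳ (4 + k)) ⟩
  -- The added term is the difference 3 (3 + k)² - (4 + k)².
  (4 + k) * (4 + k)         ≤⟨ m≤m+n _ (11 + 10 * k + 2 * (k * k)) ⟩
  (4 + k) * (4 + k) + (11 + 10 * k + 2 * (k * k)) ≡⟨ rearrange k ⟩
  3 * ((3 + k) * (3 + k))   ≡⟨ cong (λ x → 3 * ((3 + k) * x)) (*-identityʳ (3 + k)) ⟨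
  3 * (3 + k) ^ 2           ≤⟨ *-monoʳ-≤ 3 (square-≤ k) ⟩
  3 ^ (3 + k)               ∎
  where
  open ≤-Reasoning
  rearrange : ∀ k → (4 + k) * (4 + k) + (11 + 10 * k + 2 * (k * k)) ≡ 3 * ((3 + k) * (3 + k))
  rearrange = solve-∀

module StarTheory {n} (G : Graph n) where
  open Graph G using (adj; irrefl; _~_) renaming (sym to adj-sym)
  open PackingTheory G
  open DecMembership (Fin._≟_ {n}) using (_∈?_)

  -- The index concatenates the vertices of the stars; the separate `l` guarantees a leaf.
  -- Disjointness is expressed by `Unique` of the index.
  data Stars : List (Fin n) → Set where
    none : Stars []
    star : ∀ c l ls {vs} → All (c ~_) (l ∷ ls) → Stars vs → Stars ((c ∷ l ∷ ls) ++ vs)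

  ~-sym : ∀ {u v} → u ~ v → v ~ u
  ~-sym {u} {v} u~v = trans (adj-sym v u) u~v

  -- A new neighbour v of a leaf u leaves a single edge with u as the new
  -- centre, and otherwise splits off a star together with u.
  attach : ∀ {vs u v} → Stars vs → u ∈ vs → u ~ v → Σ[ ws ∈ List (Fin n) ] Stars ws × ws ↭ v ∷ vs
  attach {u = u} {v} (star c l ls c~ S) (here refl) u~v =
    _ , star c v (l ∷ ls) (u~v ∷ c~) S , Perm.swap c v Perm.refl
  attach {u = u} {v} (star c l ls {vs} c~ S) (there u∈) u~v with ∈-++⁻ (l ∷ ls) u∈
  ... | inj₂ u∈vs with ws , S′ , ws↭ ← attach S u∈vs u~v =
    _ , star c l ls c~ S′ , ↭-trans (Perm.++⁺ˡ (c ∷ l ∷ ls) ws↭) (shift v (c ∷ l ∷ ls) vs)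
  ... | inj₁ u∈ls with as , bs , eq ← ∈-∃++ u∈ls = split as bs eq c~
    where
    split : ∀ as bs → l ∷ ls ≡ as ++ u ∷ bs → All (c ~_) (l ∷ ls) →
      Σ[ ws ∈ List (Fin n) ] Stars ws × ws ↭ v ∷ c ∷ (l ∷ ls) ++ vs
    split as bs eq c~ = subst (λ xs → All (c ~_) xs → Σ[ ws ∈ List (Fin n) ] Stars ws × ws ↭ v ∷ c ∷ xs ++ vs)
                          (sym eq) (λ c~ → rebuild (as ++ bs) (shift u as bs) (Perm.All-resp-↭ (shift u as bs) c~)) c~
      where
      rebuild : ∀ {xs} rest → xs ↭ u ∷ rest → All (c ~_) (u ∷ rest) →
        Σ[ ws ∈ List (Fin n) ] Stars ws × ws ↭ v ∷ c ∷ xs ++ vs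
      rebuild []         xs↭ (c~u ∷ []) =
        _ , star u v (c ∷ []) (u~v ∷ ~-sym c~u ∷ []) S ,
        ↭-trans (Perm.swap u v Perm.refl)
          (Perm.prep v (↭-trans (Perm.swap u c Perm.refl) (Perm.prep c (Perm.++⁺ʳ vs (↭-sym xs↭)))))
      rebuild (l′ ∷ ls′) xs↭ (_ ∷ c~ls′) =
        _ , star c l′ ls′ c~ls′ (star u v [] (u~v ∷ []) S) ,
        ↭-trans (Perm.shifts (c ∷ l′ ∷ ls′) (u ∷ v ∷ []))
          (↭-trans (Perm.swap u v Perm.refl)
            (Perm.prep v (↭-trans (Perm.swap u c Perm.refl) (Perm.prep c (Perm.++⁺ʳ vs (↭-sym xs↭))))))

  -- An uncovered vertex has some neighbour u. If u is covered, the vertex is attached to the star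
  -- of u; otherwise the edge between them is a new star.
  cover : NoIsolatedVertices G → ∀ xs → Σ[ vs ∈ List (Fin n) ] Stars vs × Unique vs × (∀ {x} → x ∈ xs → x ∈ vs)
  cover noIsolated [] = [] , none , [] , λ ()
  cover noIsolated (x ∷ xs) with vs , S , unique , covered ← cover noIsolated xs with x ∈? vs
  ... | yes x∈vs = vs , S , unique , λ { (here refl) → x∈vs ; (there y∈xs) → covered y∈xs }
  ... | no  x∉vs with u , x~u ← noIsolated x with u ∈? vs
  ...   | yes u∈vs with ws , S′ , ws↭ ← attach S u∈vs (~-sym x~u) =
          ws , S′ , Unique-resp-↭ (↭-sym ws↭) (All.¬Any⇒All¬ vs x∉vs ∷ unique) ,
          ∈-resp-↭ (↭-sym ws↭) ∘ λ { (here refl) → here refl ; (there y∈xs) → there (covered y∈xs) }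
  ...   | no  u∉vs =
          x ∷ u ∷ vs , star x u [] (x~u ∷ []) S ,
          ((λ { refl → contradiction (trans (sym x~u) (irrefl x)) λ () }) ∷ All.¬Any⇒All¬ vs x∉vs) ∷
            All.¬Any⇒All¬ vs u∉vs ∷ unique ,
          λ { (here refl) → here refl ; (there y∈xs) → there (there (covered y∈xs)) }

  -- A packing contains at most one vertex of each star; its code tells which one.
  pick : (Fin n → ℕ) → List (Fin n) → Maybe (Fin n)
  pick a []       = nothing
  pick a (v ∷ vs) = ifZero a v then pick a vs else just v

  pick-∈ : ∀ a vs → pick a vs ∈ nothing ∷ map just vs
  pick-∈ a []       = here refl
  pick-∈ a (v ∷ vs) with a v
  ... | suc _ = there (here refl)
  ... | zero with pick-∈ a vs
  ...   | here eq  = here eq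
  ...   | there p∈ = there (there p∈)

  pick-just : ∀ a vs {w} → pick a vs ≡ just w → w ∈ vs × 0 < a w
  pick-just a (v ∷ vs) eq with a v in av
  ... | zero with w∈ , aw>0 ← pick-just a vs eq = there w∈ , aw>0
  pick-just a (v ∷ vs) refl | suc _ = here refl , subst (0 <_) (sym av) (s≤s z≤n)

  pick-∃ : ∀ a vs {v} → v ∈ vs → 0 < a v → ∃ λ w → pick a vs ≡ just w
  pick-∃ a (x ∷ vs) v∈ av>0 with a x in ax
  ... | suc _ = x , refl
  pick-∃ a (x ∷ vs) (here refl) av>0 | zero = contradiction (subst (0 <_) ax av>0) λ ()
  pick-∃ a (x ∷ vs) (there v∈)  av>0 | zero = pick-∃ a vs v∈ av>0

  codes : ∀ {vs} → Stars vs → List (List (Maybe (Fin n)))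
  codes none              = [] ∷ []
  codes (star c l ls _ S) = cartesianProductWith _∷_ (nothing ∷ map just (c ∷ l ∷ ls)) (codes S)

  starCode : ∀ {vs} → Stars vs → (Fin n → ℕ) → List (Maybe (Fin n))
  starCode none              a = []
  starCode (star c l ls _ S) a = pick a (c ∷ l ∷ ls) ∷ starCode S a

  starCode-∈ : ∀ {vs} (S : Stars vs) a → starCode S a ∈ codes S
  starCode-∈ none              a = here refl
  starCode-∈ (star c l ls _ S) a = ∈-cartesianProductWith⁺ _∷_ (pick-∈ a (c ∷ l ∷ ls)) (starCode-∈ S a)

  star-near : ∀ {c ls u} → All (c ~_) ls → u ∈ c ∷ ls → Near c u
  star-near c~ (here refl) = inj₁ refl
  star-near c~ (there u∈)  = inj₂ (All.lookup c~ u∈)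

  -- Since v is the only element of the packing in its star, the code names v, and an equal code
  -- puts v into the other set.
  starCode-reflects : ∀ {vs} (S : Stars vs) {a b} → Packing a → starCode S a ≡ starCode S b →
    ∀ {v} → v ∈ vs → 0 < a v → 0 < b v
  starCode-reflects (star c l ls c~ S) {a} {b} pa eq {v} v∈ av>0
    with eq₁ , eq₂ ← ∷-injective eq with ∈-++⁻ (c ∷ l ∷ ls) v∈
  ... | inj₂ v∈vs = starCode-reflects S {a} {b} pa eq₂ v∈vs av>0
  ... | inj₁ v∈star with w , pw ← pick-∃ a (c ∷ l ∷ ls) v∈star av>0
                    with w∈star , aw>0 ← pick-just a (c ∷ l ∷ ls) pw
                    with refl ← packing-near {a} pa (star-near c~ v∈star) (star-near c~ w∈star) av>0 aw>0 =
    proj₂ (pick-just b (c ∷ l ∷ ls) (trans (sym eq₁) pw))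

  codes-≤ : ∀ {vs} (S : Stars vs) → length (codes S) ^ 2 ≤ 3 ^ length vs
  codes-≤ none = ≤-refl
  codes-≤ (star c l ls {vs} c~ S) = begin
    length (codes (star c l ls c~ S)) ^ 2
      ≡⟨ cong (_^ 2) (length-cartesianProductWith _∷_ (nothing ∷ map just (c ∷ l ∷ ls)) (codes S)) ⟩
    ((3 + length (map just ls)) * length (codes S)) ^ 2
      ≡⟨ cong (λ k → ((3 + k) * length (codes S)) ^ 2) (length-map just ls) ⟩
    ((3 + length ls) * length (codes S)) ^ 2
      ≡⟨ square-* (3 + length ls) (length (codes S)) ⟩
    (3 + length ls) ^ 2 * length (codes S) ^ 2
      ≤⟨ *-mono-≤ (square-≤ (length ls)) (codes-≤ S) ⟩
    3 ^ (2 + length ls) * 3 ^ length vs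
      ≡⟨ ^-distribˡ-+-* 3 (2 + length ls) (length vs) ⟨
    3 ^ (2 + length ls + length vs)
      ≡⟨ cong (λ k → 3 ^ (2 + k)) (length-++ ls) ⟨
    3 ^ length ((c ∷ l ∷ ls) ++ vs) ∎
    where open ≤-Reasoning

  module _ {A : Set} (char : A → Fin n → ℕ) where

    -- Star codes map the packings injectively into `codes S`. The stars are disjoint, so they have
    -- at most n vertices altogether.
    packings-≤ : NoIsolatedVertices G → ∀ {xs} → Unique xs →
      All (λ x → Packing (char x)) xs →
      (∀ {x y} → x ∈ xs → y ∈ xs → (∀ v → 0 < char x v → 0 < char y v) → (∀ v → 0 < char y v → 0 < char x v) → x ≡ y) →
      length xs ^ 2 ≤ 3 ^ n
    packings-≤ noIsolated {xs} unique packings char-injective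
      with vs , S , unique-vs , covered ← cover noIsolated (allFin n) = begin
      length xs ^ 2                           ≡⟨ cong (_^ 2) (length-map (starCode S ∘ char) xs) ⟨
      length (map (starCode S ∘ char) xs) ^ 2 ≤⟨ ^-monoˡ-≤ 2 (Unique-⊆⇒length-≤ unique-codes codes-∈) ⟩
      length (codes S) ^ 2                    ≤⟨ codes-≤ S ⟩
      3 ^ length vs                           ≤⟨ ^-monoʳ-≤ 3 (Unique-⊆⇒length-≤ unique-vs λ _ → ∈-allFin _) ⟩
      3 ^ length (allFin n)                   ≡⟨ cong (3 ^_) (length-tabulate {n = n} (λ i → i)) ⟩
      3 ^ n                                   ∎
      where
      open ≤-Reasoning
      codes-∈ : ∀ {w} → w ∈ map (starCode S ∘ char) xs → w ∈ codes S
      codes-∈ w∈ with x , _ , refl ← ∈-map⁻ (starCode S ∘ char) w∈ = starCode-∈ S (char x)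
      member : All (_∈ xs) xs
      member = All.tabulate λ x∈ → x∈
      unique-codes : Unique (map (starCode S ∘ char) xs)
      unique-codes = Unique-map member
        (λ {x} {y} x∈ y∈ eq → char-injective x∈ y∈
          (λ v → starCode-reflects S {char x} {char y} (All.lookup packings x∈) eq (covered (∈-allFin v)))
          (λ v → starCode-reflects S {char y} {char x} (All.lookup packings y∈) (sym eq) (covered (∈-allFin v))))
        unique

-- The enumerated words

lookup-++ˡ : ∀ xs ys {j} → j < length xs → (xs ++ ys) [ j ] ≡ xs [ j ]
lookup-++ˡ (x ∷ xs) ys {zero}  p       = refl
lookup-++ˡ (x ∷ xs) ys {suc j} (s≤s p) = lookup-++ˡ xs ys p

lookup-++ʳ : ∀ xs ys j → (xs ++ ys) [ length xs + j ] ≡ ys [ j ]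
lookup-++ʳ []       ys j = refl
lookup-++ʳ (x ∷ xs) ys j = lookup-++ʳ xs ys j

lookup-map-tabulate : ∀ {A : Set} {m} (f : A → ℕ) (h : Fin m → A) u → map f (tabulate h) [ toℕ u ] ≡ f (h u)
lookup-map-tabulate f h zero    = refl
lookup-map-tabulate f h (suc u) = lookup-map-tabulate f (h ∘ suc) u

lookup-concatMap : ∀ {A : Set} {m k} (g : A → Memory) (h : Fin m → A) → (∀ x → length (g x) ≡ k) →
  ∀ v (u : Fin k) → concatMap g (tabulate h) [ toℕ v * k + toℕ u ] ≡ g (h v) [ toℕ u ]
lookup-concatMap g h len zero u =
  lookup-++ˡ (g (h zero)) _ (subst (toℕ u <_) (sym (len (h zero))) (Fin.toℕ<n u))
lookup-concatMap {k = k} g h len (suc v) u =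
  trans (cong (concatMap g (tabulate h) [_])
          (trans (+-assoc k (toℕ v * k) (toℕ u)) (cong (_+ (toℕ v * k + toℕ u)) (sym (len (h zero))))))
        (trans (lookup-++ʳ (g (h zero)) _ (toℕ v * k + toℕ u)) (lookup-concatMap g (h ∘ suc) len v u))

length-concatMap : ∀ {A : Set} {m k} (g : A → Memory) (h : Fin m → A) → (∀ x → length (g x) ≡ k) →
  length (concatMap g (tabulate h)) ≡ m * k
length-concatMap {m = zero}  g h len = refl
length-concatMap {m = suc m} g h len =
  trans (length-++ (g (h zero))) (cong₂ _+_ (len (h zero)) (length-concatMap g (h ∘ suc) len))

cell-≤ : ∀ {b m} → All (_≤ b) m → ∀ a → m [ a ] ≤ b
cell-≤ []       a       = z≤n
cell-≤ (p ∷ ps) zero    = p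
cell-≤ (p ∷ ps) (suc a) = cell-≤ ps a

cells-injective : ∀ A B → length A ≡ length B → (∀ v → v < length A → cells A [ v ] ≡ cells B [ v ]) → A ≡ B
cells-injective []      []      _   eq = refl
cells-injective (a ∷ A) (b ∷ B) len eq =
  cong₂ _∷_ (bit-injective a b (eq 0 (s≤s z≤n)))
            (cells-injective A B (cong pred len) (λ v v< → eq (suc v) (s≤s v<)))
  where
  bit-injective : ∀ a b → bit a ≡ bit b → a ≡ b
  bit-injective true  true  _ = refl
  bit-injective false false _ = refl

-- Clearing the lower positions gives the least set with the given upper ones. As packings are
-- closed under subsets, a failed test of this set rules out all its extensions.
fill-least : ∀ B {V W} → (∀ k → cells V [ k ] ≤ cells W [ k ]) →
  ∀ k → cells (fill (length B) V) [ k ] ≤ cells (B ʳ++ W) [ k ]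
fill-least []      V≤W = V≤W
fill-least (b ∷ B) V≤W = fill-least B λ { zero → z≤n ; (suc k) → V≤W k }

adjacencyRow : ∀ {n} → Graph n → Fin n → Memory
adjacencyRow {n} G u = map (λ v → bit (Graph.adj G u v)) (allFin n)

length-adjacencyRow : ∀ {n} (G : Graph n) u → length (adjacencyRow G u) ≡ n
length-adjacencyRow {n} G u = trans (length-map _ (allFin n)) (length-tabulate {n = n} (λ i → i))

-- Scan results in terms of closed neighbourhoods

module Enumeration {n} (G : Graph n) where
  open Graph G using (adj)
  open PackingTheory G
  open Program-correctness n (encode G) public

  -- The address has the shape produced by `gather-∑` and `lines-tabulate`; the 1 skips the cell of
  -- the order.
  encode-lookup : ∀ v u → encode G [ toℕ u + (toℕ v * n + 1) ] ≡ bit (adj v u)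
  encode-lookup v u = begin
    encode G [ toℕ u + (toℕ v * n + 1) ]
      ≡⟨ cong (encode G [_]) (trans (+-comm (toℕ u) _) (trans (cong (_+ toℕ u) (+-comm (toℕ v * n) 1)) refl)) ⟩
    concatMap (adjacencyRow G) (allFin n) [ toℕ v * n + toℕ u ]
      ≡⟨ lookup-concatMap (adjacencyRow G) (λ i → i) (length-adjacencyRow G) v u ⟩
    adjacencyRow G v [ toℕ u ]
      ≡⟨ lookup-map-tabulate _ (λ i → i) u ⟩
    bit (adj v u) ∎
    where
    open ≡-Reasoning

  char : List Bool → Fin n → ℕ
  char A v = cells A [ toℕ v ]

  gather-∑ : ∀ xs m p u s → gather xs m p u s ≡ ∑ {m} (λ i → xs [ toℕ i + u ] ∸ (1 ∸ encode G [ toℕ i + p ])) + s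
  gather-∑ xs zero    p u s = refl
  gather-∑ xs (suc m) p u s = begin
    gather xs m (suc p) (suc u) (t + s)
      ≡⟨ gather-∑ xs m (suc p) (suc u) (t + s) ⟩
    ∑ {m} (λ i → xs [ toℕ i + suc u ] ∸ (1 ∸ encode G [ toℕ i + suc p ])) + (t + s)
      ≡⟨ cong (_+ (t + s)) (cong sum (tabulate-cong {n = m} λ i →
           cong₂ (λ u p → xs [ u ] ∸ (1 ∸ encode G [ p ])) (+-suc (toℕ i) u) (+-suc (toℕ i) p))) ⟩
    rest + (t + s)
      ≡⟨ +-assoc rest t s ⟨
    rest + t + s
      ≡⟨ cong (_+ s) (+-comm rest t) ⟩
    t + rest + s ∎
    where
    open ≡-Reasoning
    t rest : ℕ
    t = xs [ u ] ∸ (1 ∸ encode G [ p ])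
    rest = ∑ {m} (λ i → xs [ suc (toℕ i) + u ] ∸ (1 ∸ encode G [ suc (toℕ i) + p ]))

  lines-tabulate : ∀ xs m p v →
    lines xs m p v ≡ tabulate {n = m} (λ i → gather xs n (toℕ i * n + p) 0 (xs [ toℕ i + v ]) , xs [ toℕ i + v ])
  lines-tabulate xs zero    p v = refl
  lines-tabulate xs (suc m) p v = cong (_ ∷_) (trans (lines-tabulate xs m (n + p) (suc v))
    (tabulate-cong {n = m} λ i → cong₂ (λ p v → gather xs n p 0 (xs [ v ]) , xs [ v ])
      (trans (sym (+-assoc (toℕ i * n) n p)) (cong (_+ p) (+-comm (toℕ i * n) n))) (+-suc (toℕ i) v)))

  lines-closedSum : ∀ A → lines (cells A) n 1 0 ≡ tabulate (λ v → closedSum (char A) v , char A v)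
  lines-closedSum A = trans (lines-tabulate (cells A) n 1 0) (tabulate-cong λ v → cong₂ _,_
    (trans (gather-∑ (cells A) n (toℕ v * n + 1) 0 _)
      (cong₂ _+_
        (cong sum (tabulate-cong λ u → cong₂ (λ x y → cells A [ x ] ∸ (1 ∸ y))
          (+-identityʳ (toℕ u)) (encode-lookup v u)))
        (cong (cells A [_]) (+-identityʳ (toℕ v)))))
    (cong (cells A [_]) (+-identityʳ (toℕ v))))

  labels-label : ∀ A → labels A ≡ tabulate (label (char A))
  labels-label A = trans (cong labelsOf (lines-closedSum A)) (map-tabulate _ _)

  excess-∑ : ∀ A → excess A ≡ ∑ (λ v → closedSum (char A) v ∸ 1)
  excess-∑ A = trans (cong excessOf (lines-closedSum A)) (cong sum (map-tabulate {n = n} _ _))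

  excess≡0⇒Packing : ∀ A → excess A ≡ 0 → Packing (char A)
  excess≡0⇒Packing A eq v = m∸n≡0⇒m≤n (n≤0⇒n≡0
    (≤-trans (term≤∑ (λ v → closedSum (char A) v ∸ 1) v) (≤-reflexive (trans (sym (excess-∑ A)) eq))))

  Packing⇒excess≡0 : ∀ A → Packing (char A) → excess A ≡ 0
  Packing⇒excess≡0 A packing = trans (excess-∑ A) (∑-zero λ v → m≤n⇒m∸n≡0 (packing v))

  excess-anti : ∀ A B → (∀ k → cells A [ k ] ≤ cells B [ k ]) → excess B ≡ 0 → excess A ≡ 0
  excess-anti A B A≤B eq =
    Packing⇒excess≡0 A (Packing-anti {char A} {char B} (A≤B ∘ toℕ) (excess≡0⇒Packing B eq))

  -- The packings visited: soundness, distinctness, completeness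

  candidates : ℕ → List Bool → List (List Bool)
  candidates i V = fill i V ∷ later i V

  Extends : ℕ → List Bool → List Bool → Set
  Extends i V A = length A ≡ i + length V × excess A ≡ 0 × (∀ k → cells A [ i + k ] ≡ cells V [ k ])

  Extends-∷ : ∀ {i b V A} → Extends i (b ∷ V) A → Extends (suc i) V A
  Extends-∷ {i} {b} {V} {A} (len , ok , agrees) =
    trans len (+-suc i (length V)) , ok ,
    λ k → trans (cong (cells A [_]) (sym (+-suc i k))) (agrees (suc k))

  Extends-head : ∀ {i b V A} → Extends i (b ∷ V) A → cells A [ i ] ≡ bit b
  Extends-head {i} {A = A} (_ , _ , agrees) = trans (cong (cells A [_]) (sym (+-identityʳ i))) (agrees 0)

  candidates-extend : ∀ i V → excess (fill i V) ≡ 0 → All (Extends i V) (candidates i V)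
  candidates-extend zero    V ok = (refl , ok , λ k → refl) ∷ []
  candidates-extend (suc i) V ok =
    All.++⁺ (All.map (λ {A} → Extends-∷ {A = A}) (candidates-extend i (false ∷ V) ok)) (upper _ refl)
    where
    upper : ∀ e → excess (fill i (true ∷ V)) ≡ e →
      All (Extends (suc i) V) (ifZero e then candidates i (true ∷ V) else [])
    upper zero    ok′ = All.map (λ {A} → Extends-∷ {A = A}) (candidates-extend i (true ∷ V) ok′)
    upper (suc _) _   = []

  -- The sets from the two sweeps differ in bit i.
  candidates-unique : ∀ i V → excess (fill i V) ≡ 0 → Unique (candidates i V)
  candidates-unique zero    V ok = [] ∷ []
  candidates-unique (suc i) V ok = upper _ refl
    where
    upper : ∀ e → excess (fill i (true ∷ V)) ≡ e →
      Unique (candidates i (false ∷ V) ++ (ifZero e then candidates i (true ∷ V) else []))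
    upper zero ok′ = Unique.++⁺ (candidates-unique i (false ∷ V) ok) (candidates-unique i (true ∷ V) ok′)
      λ {A} (A∈ , A∈′) → contradiction
        (trans (sym (Extends-head {A = A} (All.lookup (candidates-extend i (false ∷ V) ok) A∈)))
               (Extends-head {A = A} (All.lookup (candidates-extend i (true ∷ V) ok′) A∈′)))
        λ ()
    upper (suc _) _ = Unique.++⁺ (candidates-unique i (false ∷ V) ok) [] λ ()

  -- `B` lists the undecided bits from the highest position down, in the order of the recursion. If
  -- the next bit is 1, the set tested there is contained in the target packing, so the test
  -- succeeds.
  candidates-complete : ∀ B V → excess (B ʳ++ V) ≡ 0 → B ʳ++ V ∈ candidates (length B) V
  candidates-complete []          V ok = here refl
  candidates-complete (false ∷ B) V ok = ∈-++⁺ˡ (candidates-complete B (false ∷ V) ok)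
  candidates-complete (true ∷ B)  V ok
    with eq ← excess-anti (fill (length B) (true ∷ V)) (B ʳ++ true ∷ V) (fill-least B (λ k → ≤-refl)) ok
    rewrite eq = ∈-++⁺ʳ (candidates (length B) (false ∷ V)) (candidates-complete B (true ∷ V) ok)

  all : List (List Bool)
  all = candidates n []

  fill-empty : ∀ i V → (∀ k → cells V [ k ] ≡ 0) → ∀ k → cells (fill i V) [ k ] ≡ 0
  fill-empty zero    V V≡0 = V≡0
  fill-empty (suc i) V V≡0 = fill-empty i (false ∷ V) λ { zero → refl ; (suc k) → V≡0 k }

  empty-ok : excess (fill n []) ≡ 0
  empty-ok = Packing⇒excess≡0 (fill n []) (∅-packing {char (fill n [])} λ v → fill-empty n [] (λ k → refl) (toℕ v))

  all-sound : ∀ {A} → A ∈ all → length A ≡ n × Packing (char A)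
  all-sound {A} A∈ with len , ok , _ ← All.lookup (candidates-extend n [] empty-ok) A∈ =
    trans len (+-identityʳ n) , excess≡0⇒Packing A ok

  all-complete : ∀ {A} → length A ≡ n → Packing (char A) → A ∈ all
  all-complete {A} len packing =
    subst₂ (λ A′ i → A′ ∈ candidates i []) (reverse-involutive A) (trans (length-reverse A) len)
      (candidates-complete (reverse A) []
        (trans (cong excess (reverse-involutive A)) (Packing⇒excess≡0 A packing)))

  char-injective : ∀ {A B} → length A ≡ n → length B ≡ n → (∀ v → char A v ≡ char B v) → A ≡ B
  char-injective {A} {B} lenA lenB eq = cells-injective A B (trans lenA (sym lenB)) λ v v< →
    subst (λ k → cells A [ k ] ≡ cells B [ k ]) (Fin.toℕ-fromℕ< (subst (v <_) lenA v<))
      (eq (fromℕ< (subst (v <_) lenA v<)))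

  all-unique : Unique all
  all-unique = candidates-unique n [] empty-ok

  tabulate-injective : ∀ {m} {f g : Fin m → ℕ} → tabulate f ≡ tabulate g → ∀ v → f v ≡ g v
  tabulate-injective {suc m} eq zero    = proj₁ (∷-injective eq)
  tabulate-injective {suc m} eq (suc v) = tabulate-injective (proj₂ (∷-injective eq)) v

  labels-unique : Unique (map labels all)
  labels-unique = Unique-map (All.tabulate λ A∈ → A∈)
    (λ {A} {B} A∈ B∈ eq →
      let lenA , pA = all-sound A∈
          lenB , pB = all-sound B∈
      in char-injective lenA lenB λ v → label-injective {char A} {char B} pA pB v
           (tabulate-injective (trans (sym (labels-label A)) (trans eq (labels-label B))) v))
    all-unique

  all-length : NoIsolatedVertices G → length all ^ 2 ≤ 3 ^ n
  all-length noIsolated = StarTheory.packings-≤ G char noIsolated all-unique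
    (All.tabulate (proj₂ ∘ all-sound))
    λ {A} {B} A∈ B∈ A⇒B B⇒A → char-injective (proj₁ (all-sound A∈)) (proj₁ (all-sound B∈))
      λ v → same (cells-≤1 A (toℕ v)) (cells-≤1 B (toℕ v)) (A⇒B v) (B⇒A v)
    where
    same : ∀ {x y} → x ≤ 1 → y ≤ 1 → (0 < x → 0 < y) → (0 < y → 0 < x) → x ≡ y
    same z≤n       z≤n       _ _ = refl
    same z≤n       (s≤s z≤n) _ f = contradiction (f (s≤s z≤n)) λ ()
    same (s≤s z≤n) z≤n       f _ = contradiction (f (s≤s z≤n)) λ ()
    same (s≤s z≤n) (s≤s z≤n) _ _ = refl

  enumerates : Enumerates (map labels all) (EncodesURRDF G)
  enumerates = labels-unique , λ w → mk⇔ (sound w) (complete w)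
    where
    sound : ∀ w → w ∈ map labels all → EncodesURRDF G w
    sound w w∈ with A , A∈ , refl ← ∈-map⁻ labels w∈ =
      let packing = proj₂ (all-sound A∈) in
      toFunction packing , packing⇒URRDF packing ,
      trans (labels-label A) (tabulate-cong λ v → sym (toℕ-toFunction packing v))
    complete : ∀ w → EncodesURRDF G w → w ∈ map labels all
    complete w (f , urrdf , refl) = subst (_∈ map labels all)
      (trans (labels-label A) (tabulate-cong λ v →
        trans (label-cong char-A v) (label-twos v)))
      (∈-map⁺ labels (all-complete (length-tabulate _) packing))
      where
      open FromURRDF urrdf
      A : List Bool
      A = tabulate (isTwo ∘ f)
      char-A : ∀ v → char A v ≡ twos v
      char-A v = lookup-map-tabulate bit (isTwo ∘ f) v
      packing : Packing (char A)
      packing = Packing-anti {char A} {twos} (λ v → ≤-reflexive (char-A v)) twos-packing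
      -- `char A` and `twos` are known to agree pointwise, so their labels are compared by
      -- congruence.
      closedSum-cong : ∀ {a b} → (∀ v → a v ≡ b v) → ∀ v → closedSum a v ≡ closedSum b v
      closedSum-cong a≡b v =
        cong₂ _+_ (cong sum (tabulate-cong λ u → cong (_∸ (1 ∸ bit (adj v u))) (a≡b u))) (a≡b v)
      label-cong : ∀ {a b} → (∀ v → a v ≡ b v) → ∀ v → label a v ≡ label b v
      label-cong a≡b v = cong₂ (λ x s → 1 + (x + x) ∸ s) (a≡b v) (closedSum-cong a≡b v)

-- Bounds

n≤2^n : ∀ n → n ≤ 2 ^ n
n≤2^n zero    = z≤n
n≤2^n (suc n) = +-mono-≤ (m^n>0 2 n) (≤-trans (n≤2^n n) (≤-reflexive (sym (+-identityʳ _))))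

⌊log₂n⌋≤n : ∀ n → ⌊log₂ n ⌋ ≤ n
⌊log₂n⌋≤n n = ≤-trans (⌊log₂⌋-mono-≤ (n≤2^n n)) (≤-reflexive (⌊log₂[2^n]⌋≡n n))

-- Estimating the logarithm by the value itself is good enough when cell contents are polynomially
-- bounded.
bits-≤ : ∀ m {b} → (∀ a → m [ a ] ≤ b) → bits m ≤ length m * suc b
bits-≤ []      c = z≤n
bits-≤ (v ∷ m) c = +-mono-≤ (s≤s (≤-trans (⌊log₂n⌋≤n v) (c 0))) (bits-≤ m (c ∘ suc))

length≤bits : ∀ m → length m ≤ bits m
length≤bits []      = z≤n
length≤bits (v ∷ m) = +-mono-≤ (s≤s z≤n) (length≤bits m)

⟦⟧-mono-≤ : ∀ p {m n} → m ≤ n → ⟦ p ⟧ m ≤ ⟦ p ⟧ n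
⟦⟧-mono-≤ (con k) m≤n = ≤-refl
⟦⟧-mono-≤ var     m≤n = m≤n
⟦⟧-mono-≤ (p ⊕ q) m≤n = +-mono-≤ (⟦⟧-mono-≤ p m≤n) (⟦⟧-mono-≤ q m≤n)
⟦⟧-mono-≤ (p ⊗ q) m≤n = *-mono-≤ (⟦⟧-mono-≤ p m≤n) (⟦⟧-mono-≤ q m≤n)

Within : ℕ → ℕ → ℕ → Set
Within d s t = t ≤ s + d

-- `rest` accumulates the times already linked while the outputs are taken off from the end.
Paced⇒Linked : ∀ {d d′ ts s rest} → d ≤ d′ → Paced d ts s → Linked (Within d′) (s ∷ rest) →
  Linked (Within d′) (0 ∷ ts ++ rest)
Paced⇒Linked d≤d′ start linked = linked
Paced⇒Linked {rest = rest} d≤d′ (output {ts} {s} {t} paced t≤) linked =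
  subst (λ xs → Linked _ (0 ∷ xs)) (sym (++-assoc ts (t ∷ []) rest))
    (Paced⇒Linked d≤d′ paced (≤-trans t≤ (+-monoʳ-≤ s d≤d′) ∷ linked))

Paced⇒≤ : ∀ {d ts s} → Paced d ts s → s ≤ length ts * d
Paced⇒≤ start = z≤n
Paced⇒≤ {d} (output {ts} {s} {t} paced t≤) = begin
  t                           ≤⟨ t≤ ⟩
  s + d                       ≤⟨ +-monoˡ-≤ d (Paced⇒≤ paced) ⟩
  length ts * d + d           ≡⟨ +-comm (length ts * d) d ⟩
  suc (length ts) * d         ≡⟨ cong (_* d) (trans (length-++ ts) (+-comm (length ts) 1)) ⟨
  length (ts ++ t ∷ []) * d   ∎
  where open ≤-Reasoning

n≤n*n : ∀ n → n ≤ n * n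
n≤n*n zero    = z≤n
n≤n*n (suc n) = m≤m*n (suc n) (suc n)

encode-≤ : ∀ {n} (G : Graph n) → All (_≤ 14 + (n + n * n)) (encode G)
encode-≤ {n} G = ≤-trans (m≤m+n n (n * n)) (m≤n+m _ 14) ∷
  All.concat⁺ (All.map⁺ (All.tabulate {xs = allFin n} λ _ → All.map⁺ (All.tabulate λ _ → bit≤ _)))
  where
  bit≤ : ∀ b → bit b ≤ 14 + (n + n * n)
  bit≤ true  = s≤s z≤n
  bit≤ false = z≤n

-- Each of the n * n matrix cells occupies at least one bit. By monotonicity, polynomial bounds in n
-- become bounds in the input size.
order≤inputSize : ∀ {n} (G : Graph n) → n ≤ inputSize G
order≤inputSize {n} G = ≤-trans (n≤n*n n) (≤-trans
  (≤-trans (≤-reflexive (sym (length-concatMap (adjacencyRow G) (λ i → i) (length-adjacencyRow G))))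
           (n≤1+n _))
  (length≤bits (encode G)))

-- At n, `spaceBound` and `delayBound` evaluate to `L * suc B` and `maxDelay`. The factor 2 in
-- `timeBound` absorbs the delay after the last output.
spaceBound scanBound delayBound timeBound : Polynomial
spaceBound = (con 14 ⊕ var) ⊗ (con 15 ⊕ (var ⊕ (var ⊗ var)))
scanBound  = con 4 ⊕ (var ⊗ (con 12 ⊕ (var ⊗ con 9)))
delayBound = con 2 ⊕ ((con 1 ⊕ var) ⊗ (con 7 ⊕ (scanBound ⊕ scanBound)))
timeBound  = con 2 ⊗ delayBound

rearrange-clock : ∀ x y → x * y + x * y ≡ 2 * y * x
rearrange-clock = solve-∀

-- Space, delay and total time of the run

module _ {n} (G : Graph n) (noIsolated : NoIsolatedVertices G) where
  open Enumeration G
  open Execution 14 L B (encode G)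

  -- Squaring states the time bound with √3 in natural numbers.
  Correct : Config → Set
  Correct c = Halted c × Enumerates (outputs c) (EncodesURRDF G) ×
    DelayAtMost (⟦ delayBound ⟧ (inputSize G)) c ×
    clock c ^ 2 ≤ ⟦ timeBound ⟧ (inputSize G) ^ 2 * 3 ^ n

  maxDelay≤ : maxDelay ≤ ⟦ delayBound ⟧ (inputSize G)
  maxDelay≤ = ⟦⟧-mono-≤ delayBound (order≤inputSize G)

  space-≤ : ∀ {c c′} → memory c ≡ [] → c ⇝ c′ → Halted c′ →
    ∀ t → bits (memory (fold c (step (encode G)) t)) ≤ ⟦ spaceBound ⟧ (inputSize G)
  space-≤ {c} empty trace halted t =
    bound (always-safe (m≤m+n 14 n) (m≤m+n 14 (n + n * n)) (cell-≤ (encode-≤ G)) trace halted initial t)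
    where
    initial : Safe L B (memory c)
    initial = subst (Safe L B) (sym empty) (safe z≤n λ _ → z≤n)
    bound : ∀ {m} → Safe L B m → bits m ≤ ⟦ spaceBound ⟧ (inputSize G)
    bound {m} (safe l b) =
      ≤-trans (bits-≤ m b) (≤-trans (*-monoˡ-≤ (suc B) l) (⟦⟧-mono-≤ spaceBound (order≤inputSize G)))

  clock-≤ : ∀ {s} c → outputs c ≡ map labels all → Paced-log (log c) s → clock c ≤ s + maxDelay →
    clock c ≤ ⟦ timeBound ⟧ (inputSize G) * length all
  clock-≤ {s} c outputs≡ paced clock≤ = begin
    clock c                                  ≤⟨ clock≤ ⟩
    s + maxDelay                             ≤⟨ +-monoˡ-≤ maxDelay (Paced⇒≤ paced) ⟩
    length (map proj₁ (log c)) * maxDelay + maxDelay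
      ≡⟨ cong (λ k → k * maxDelay + maxDelay) outputs-count ⟩
    -- The list `all` begins with the empty packing, so its length is a successor and
    -- `length all * maxDelay` is at least one delay.
    length all * maxDelay + maxDelay         ≤⟨ +-monoʳ-≤ (length all * maxDelay) (m≤m+n maxDelay _) ⟩
    length all * maxDelay + length all * maxDelay
      ≡⟨ rearrange-clock (length all) maxDelay ⟩
    2 * maxDelay * length all                ≤⟨ *-monoˡ-≤ (length all) (*-monoʳ-≤ 2 maxDelay≤) ⟩
    ⟦ timeBound ⟧ (inputSize G) * length all ∎
    where
    open ≤-Reasoning
    outputs-count : length (map proj₁ (log c)) ≡ length all
    outputs-count = trans (length-map proj₁ (log c)) (trans (sym (length-map proj₂ (log c)))
      (trans (cong length outputs≡) (length-map labels all)))

  correct : ∀ {s} c → Halted c → outputs c ≡ map labels all → Paced-log (log c) s → clock c ≤ s + maxDelay → Correct c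
  correct {s} c halted outputs≡ paced clock≤ =
    halted ,
    subst (λ ws → Enumerates ws (EncodesURRDF G)) (sym outputs≡) enumerates ,
    Paced⇒Linked maxDelay≤ paced (≤-trans clock≤ (+-monoʳ-≤ s maxDelay≤) ∷ [-]) ,
    (begin
      clock c ^ 2                                        ≤⟨ ^-monoˡ-≤ 2 (clock-≤ c outputs≡ paced clock≤) ⟩
      (⟦ timeBound ⟧ (inputSize G) * length all) ^ 2     ≡⟨ square-* (⟦ timeBound ⟧ (inputSize G)) (length all) ⟩
      ⟦ timeBound ⟧ (inputSize G) ^ 2 * length all ^ 2   ≤⟨ *-monoʳ-≤ (⟦ timeBound ⟧ (inputSize G) ^ 2) (all-length noIsolated) ⟩
      ⟦ timeBound ⟧ (inputSize G) ^ 2 * 3 ^ n            ∎)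
    where open ≤-Reasoning

  -- With an arbitrary `c₀`, the concrete program enters only in `theorem4`.
  conclude : ∀ {c₀} → memory c₀ ≡ [] →
    (Σ[ c ∈ Config ] c₀ ⇝ c × Halted c × outputs c ≡ map labels all ×
      Σ[ s ∈ ℕ ] Paced-log (log c) s × clock c ≤ s + maxDelay) →
    (∀ t → bits (memory (fold c₀ (step (encode G)) t)) ≤ ⟦ spaceBound ⟧ (inputSize G)) ×
    (Σ[ T ∈ ℕ ] Correct (fold c₀ (step (encode G)) T))
  conclude empty (c , trace , halted , outputs≡ , s , paced , clock≤) =
    space-≤ empty trace halted ,
    proj₁ (steps trace) , subst Correct (sym (proj₂ (steps trace))) (correct c halted outputs≡ paced clock≤)

theorem4 : Σ[ prog ∈ Program ] Σ[ space ∈ Polynomial ] Σ[ delay ∈ Polynomial ] Σ[ q ∈ Polynomial ]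
    (∀ (n : ℕ) (G : Graph n) → NoIsolatedVertices G →
    (∀ t → bits (memory (run prog (encode G) t)) ≤ ⟦ space ⟧ (inputSize G)) ×
    (Σ[ T ∈ ℕ ]
    Halted (run prog (encode G) T) ×
    Enumerates (outputs (run prog (encode G) T)) (EncodesURRDF G) ×
    DelayAtMost (⟦ delay ⟧ (inputSize G)) (run prog (encode G) T) ×
    clock (run prog (encode G) T) ^ 2 ≤ ⟦ q ⟧ (inputSize G) ^ 2 * 3 ^ n))
theorem4 = program , spaceBound , delayBound , timeBound ,
  λ n G noIsolated → conclude G noIsolated refl (Enumeration.run-program G refl)
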